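{- Let $N\geq 2$ and let $\mathcal{A}$ be an $N$-colored Adinkra on $v$ vertices, with underlying (unsigned) graph $G$. Let $L(G)$ be the Laplacian of $G$, and define the integer $m$ by requiring that the rank of $L(G)$ over $\mathbb{F}_2$ equals $v/2-m$. Then $$\mathcal{K}(\mathcal{A})\cong(\mathbb{Z}/2\mathbb{Z})^m\oplus\left(\mathbb{Z}/\tfrac{N^2-N}{2}\mathbb{Z}\right)^m\oplus\left(\mathbb{Z}/(N^2-N)\mathbb{Z}\right)^{v/2-m}.$$
   Context: Graphs are finite, simple, connected. A signed graph is a graph $G$ with a map $\sigma:E(G)\to\{\pm\}$. For $N\geq 2$, an $N$-colored Adinkra is a signed graph whose edges are each colored by one of $N$ colors such that: (1) the graph is bipartite; (2) every vertex is incident to exactly one edge of each color; (3) for every pair of distinct colors, the subgraph formed by the edges of these two colors is a disjoint union of $4$-cycles; (4) each such bi-colored $4$-cycle contains an odd number of negative edges. The Laplacian of a signed graph $G_\sigma$ is $L(G_\sigma)=D-A_\sigma$, where $D$ is the diagonal matrix of vertex degrees and $A_\sigma$ is the signed adjacency matrix ($A_{xy}=A_{yx}=1$ for a positive edge $xy$, $-1$ for a negative edge, $0$ for non-edges); the Laplacian $L(G)$ of an unsigned graph is the case $\sigma\equiv +$. The critical group $\mathcal{K}(G_\sigma)$ is the torsion subgroup of the cokernel of $L(G_\sigma)$ viewed as a map $\mathbb{Z}^{V}\to\mathbb{Z}^{V}$ (for an Adinkra this cokernel is finite). -}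

module Defs where

open import Data.Nat as ℕ using (ℕ; zero; suc)
open import Data.Nat.DivMod using (_%_)
open import Data.Integer as ℤ using (ℤ; +_; _◃_)
open import Data.Integer.Divisibility using (_∣_)
open import Data.Sign as Sign using (Sign)
open import Data.Bool using (Bool; true; false; _xor_; _∧_; if_then_else_)
open import Data.Fin using (Fin; _≟_)
open import Data.Product using (Σ; ∃; _×_; _,_)
open import Relation.Binary.PropositionalEquality using (_≡_; _≢_)
open import Relation.Nullary using (¬_; yes; no)

sumℤ : ∀ {k} → (Fin k → ℤ) → ℤ
sumℤ {zero}  f = + 0
sumℤ {suc k} f = f Data.Fin.zero ℤ.+ sumℤ (λ i → f (Data.Fin.suc i))

sumF₂ : ∀ {k} → (Fin k → Bool) → Bool
sumF₂ {zero}  f = false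
sumF₂ {suc k} f = f Data.Fin.zero xor sumF₂ (λ i → f (Data.Fin.suc i))

-- N-colored Adinkras on the vertex set Fin v.
-- Edge colouring with "every vertex is incident to exactly one edge of
-- each colour" is encoded by, for every colour c, the map  nbr c  sending
-- a vertex to the other end of its unique c-coloured edge; the sign of
-- that edge is  sgn c x  (and must agree when read from the other end).

data Reachable {N v : ℕ} (nbr : Fin N → Fin v → Fin v) (x : Fin v) : Fin v → Set where
  here : Reachable nbr x x
  step : ∀ {y} → Reachable nbr x y → (c : Fin N) → Reachable nbr x (nbr c y)

record Adinkra (N v : ℕ) : Set where
  field
    nbr : Fin N → Fin v → Fin v
    sgn : Fin N → Fin v → Sign
    nbr-invol : ∀ c x → nbr c (nbr c x) ≡ x
    sgn-sym   : ∀ c x → sgn c (nbr c x) ≡ sgn c x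
    loopless  : ∀ c x → nbr c x ≢ x
    no-multi  : ∀ c d x → c ≢ d → nbr c x ≢ nbr d x
    connected : ∀ x y → Reachable nbr x y
    bipartite : ∃ λ (part : Fin v → Bool) → ∀ c x → part (nbr c x) ≢ part x
    -- (3) every two-coloured component is a 4-cycle:
    --     the alternating walk x, cx, dcx, cdcx closes up after 4 steps
    --     (distinctness of the four vertices follows from simplicity)
    four-cycles : ∀ c d x → c ≢ d → nbr d (nbr c (nbr d (nbr c x))) ≡ x
    -- (4) each bicoloured 4-cycle has an odd number of negative edges,
    --     i.e. the product of its four edge signs is negative
    odd-neg : ∀ c d x → c ≢ d →
      (sgn c x Sign.* sgn d (nbr c x)) Sign.*
      (sgn c (nbr d (nbr c x)) Sign.* sgn d (nbr c (nbr d (nbr c x))))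
        ≡ Sign.-

module _ {N v : ℕ} (A : Adinkra N v) where
  open Adinkra A

  -- degree of a vertex: number of incident edges (one per colour)
  degree : Fin v → ℤ
  degree x = sumℤ {N} (λ _ → + 1)

  adjW : (Fin N → Fin v → ℤ) → Fin v → Fin v → ℤ
  adjW w x y = sumℤ {N} (λ c → if isYes (nbr c x ≟ y) then w c x else + 0)
    where
    isYes : ∀ {P : Set} → Relation.Nullary.Dec P → Bool
    isYes (yes _) = true
    isYes (no _)  = false

  δ : Fin v → Fin v → ℤ
  δ x y with x ≟ y
  ... | yes _ = + 1
  ... | no  _ = + 0

  signedLaplacian : Fin v → Fin v → ℤ
  signedLaplacian x y = δ x y ℤ.* degree x ℤ.- adjW (λ c z → sgn c z ◃ 1) x y

  laplacian : Fin v → Fin v → ℤ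
  laplacian x y = δ x y ℤ.* degree x ℤ.- adjW (λ _ _ → + 1) x y

parity : ℤ → Bool
parity z with ℤ.∣ z ∣ % 2
... | zero = false
... | suc _ = true

LinIndepF₂ : ∀ {k n} → (Fin k → Fin n → Bool) → Set
LinIndepF₂ {k} {n} u =
  ∀ (c : Fin k → Bool) → (∀ j → sumF₂ (λ i → c i ∧ u i j) ≡ false) → ∀ i → c i ≡ false

RankF₂ : ∀ {n m} → (Fin n → Fin m → Bool) → ℕ → Set
RankF₂ {n} M r =
  (∃ λ (s : Fin r → Fin n) → LinIndepF₂ (λ i → M (s i))) ×
  (∀ (s : Fin (suc r) → Fin n) → ¬ LinIndepF₂ (λ i → M (s i)))

mod2 : ∀ {n m} → (Fin n → Fin m → ℤ) → Fin n → Fin m → Bool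
mod2 M i j = parity (M i j)

-- Cokernel of an integer matrix L : ℤ^V → ℤ^V, as a setoid on ℤ^V

_·ᵥ_ : ∀ {n} → ℤ → (Fin n → ℤ) → Fin n → ℤ
(k ·ᵥ x) i = k ℤ.* x i

_+ᵥ_ : ∀ {n} → (Fin n → ℤ) → (Fin n → ℤ) → Fin n → ℤ
(x +ᵥ y) i = x i ℤ.+ y i

matVec : ∀ {n m} → (Fin n → Fin m → ℤ) → (Fin m → ℤ) → Fin n → ℤ
matVec M z i = sumℤ (λ j → M i j ℤ.* z j)

CokerEq : ∀ {n} → (Fin n → Fin n → ℤ) → (Fin n → ℤ) → (Fin n → ℤ) → Set
CokerEq {n} L x y = ∃ λ (z : Fin n → ℤ) → ∀ i → x i ℤ.- y i ≡ matVec L z i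

IsTorsion : ∀ {n} → (Fin n → Fin n → ℤ) → (Fin n → ℤ) → Set
IsTorsion L x = ∃ λ (k : ℕ) → ℕ.NonZero k × CokerEq L ((+ k) ·ᵥ x) (λ _ → + 0)

-- The group  (ℤ/2)^a ⊕ (ℤ/p)^a ⊕ (ℤ/q)^b, elements represented by
-- integer vectors, equality = congruence componentwise.

Target : ℕ → ℕ → Set
Target a b = (Fin a → ℤ) × (Fin a → ℤ) × (Fin b → ℤ)

_+T_ : ∀ {a b} → Target a b → Target a b → Target a b
(x₁ , x₂ , x₃) +T (y₁ , y₂ , y₃) = (x₁ +ᵥ y₁) , (x₂ +ᵥ y₂) , (x₃ +ᵥ y₃)

CongMod : ℕ → ℤ → ℤ → Set
CongMod k s t = (+ k) ∣ (s ℤ.- t)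

TargetEq : ∀ {a b} → (p q : ℕ) → Target a b → Target a b → Set
TargetEq p q (x₁ , x₂ , x₃) (y₁ , y₂ , y₃) =
  (∀ i → CongMod 2 (x₁ i) (y₁ i)) ×
  (∀ i → CongMod p (x₂ i) (y₂ i)) ×
  (∀ i → CongMod q (x₃ i) (y₃ i))

-- A group isomorphism  (ℤ/2)^a ⊕ (ℤ/p)^a ⊕ (ℤ/q)^b  ≅  torsion(coker L),
-- given by a map g from the former into ℤ^V which is well defined,
-- additive, injective, and whose image is exactly the torsion subgroup.
record TorsionCokerIso {n : ℕ} (L : Fin n → Fin n → ℤ) (a b p q : ℕ) : Set where
  field
    g          : Target a b → (Fin n → ℤ)
    well-def   : ∀ s t → TargetEq p q s t → CokerEq L (g s) (g t)
    additive   : ∀ s t → CokerEq L (g (s +T t)) (g s +ᵥ g t)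
    injective  : ∀ s t → CokerEq L (g s) (g t) → TargetEq p q s t
    into-tors  : ∀ s → IsTorsion L (g s)
    onto-tors  : ∀ x → IsTorsion L x → ∃ λ s → CokerEq L (g s) x

{-# OPTIONS --safe #-}

-- Write the signed Laplacian as L = N - A. By the odd-sign condition the signed involutions A_c
-- of the single colours anticommute, so A² = N and A_c A + A A_c = 2. On the two halves of the
-- bipartition A is given by integer matrices B, B′ with B B′ = N. Diagonalising B (and with it
-- B′ = N B⁻¹) decomposes L into blocks [[N , - b] , [- b′ , N]] with b b′ = N, and the diagonal
-- entries of A_c A + A A_c = 2 give β b + β′ b′ = 2, so g = gcd(b , b′) is 1 or 2. Such a block
-- has cokernel ℤ/g ⊕ ℤ/((N² - N)/g), and it has rank 1 over 𝔽₂ if g = 1 and rank 0 if g = 2.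
-- Hence the rank of L over 𝔽₂ is the number of blocks with g = 1.
module Submission where

open import Defs
open import Data.Nat as ℕ using (zero; suc)
import Data.Nat.DivMod as ℕ
import Data.Nat.Properties as ℕ
open import Data.Bool using (Bool; true; false; _xor_; _∧_; if_then_else_)
open import Data.Fin as Fin using (Fin)
import Data.Fin.Properties as Fin
open import Data.Product using (∃; ∃₂; _×_; _,_; proj₁; proj₂)
open import Function using (_∘_)
open import Relation.Binary.PropositionalEquality hiding ([_])
open import Relation.Nullary

-- The relation B B′ = N alone would only force g² to divide N; it is a single colour c that pins g
-- down to 1 or 2. Any diagonal form of B is enough, without the divisibility chain of a Smith form,
-- because β b + β′ b′ = 2 is read off entry by entry and so holds in every block separately. No
-- zero can occur on the diagonal, as the image of B contains N ℤⁿ. For a block with input (p , q)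
-- put P = b′ p - q. The output (X , Y) then satisfies X = b P and Y + b′ X = b′ (N - 1) p, so the
-- cokernel is ℤ/b ⊕ ℤ/(b′ (N - 1)). Dividing both moduli by g leaves coprime numbers, since b/g
-- divides N and is therefore prime to N - 1. The unsigned graph enters only through the fact that
-- L(G) and the signed Laplacian agree mod 2. Linear algebra over 𝔽₂ is done with integer vectors
-- and parities, so that the integral coordinates of the blocks can be reused for the rank.

module Development where
  open import Data.Bool.Properties using (xor-assoc; xor-comm; xor-same; ∧-zeroʳ; ¬-not)
  open import Data.Fin using (funToFin; finToFun; combine)
  open import Data.Fin.Properties using (pigeonhole; finToFun-funToFin; funToFin-finToFin; ¬∀⟶∃¬)
  open import Data.Integer
    using (ℤ; +_; -[1+_]; _+_; _*_; _-_; -_; ∣_∣; 0ℤ; 1ℤ; _◃_; NonZero; ≢-nonZero)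
  open import Data.Integer.Divisibility.Signed using (∣ᵤ⇒∣; ∣⇒∣ᵤ; divides; ∣-trans; ∣m∣∣m)
  open import Data.Integer.DivMod
    using (a≡a%ℕn+[a/ℕn]*n; n%ℕd<d; _%ℕ_; _/ℕ_; a≡a%n+[a/n]*n; n%d<d; _%_; _/_)
  open import Data.Integer.Properties
  open import Data.Integer.Tactic.RingSolver using (solve-∀)
  open import Data.Nat using (ℕ)
  open import Data.Nat.DivMod using ([m+kn]%n≡m%n)
  open import Data.Nat.Induction using (<-wellFounded; Acc; acc)
  open import Data.Sign as Sign using (Sign)
  open import Data.Sum as Sum using (_⊎_; inj₁; inj₂; [_,_]′)
  open import Data.Sum.Properties using (inj₁-injective; inj₂-injective)
  open import Data.Vec using (Vec; []; _∷_; lookup; tabulate; zipWith; map; replicate; head; tail)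
  open import Data.Vec.Properties
    using (lookup-zipWith; lookup-map; lookup∘tabulate; tabulate∘lookup; tabulate-cong; lookup-replicate)
  open import Relation.Nullary.Decidable using (decidable-stable)
  open import Relation.Nullary.Negation using (¬¬-map)

  -- Finite sums and indicators over ℤ

  sum-cong : ∀ {k} {f g : Fin k → ℤ} → (∀ i → f i ≡ g i) → sumℤ f ≡ sumℤ g
  sum-cong {zero}  f≗g = refl
  sum-cong {suc k} f≗g = cong₂ _+_ (f≗g Fin.zero) (sum-cong (λ i → f≗g (Fin.suc i)))

  sum-zero : ∀ k → sumℤ {k} (λ _ → + 0) ≡ + 0
  sum-zero zero    = refl
  sum-zero (suc k) = trans (+-identityˡ _) (sum-zero k)

  sum-linear : ∀ {k} a (f g : Fin k → ℤ) → sumℤ (λ i → a * f i + g i) ≡ a * sumℤ f + sumℤ g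
  sum-linear {zero}  a f g = sym (trans (+-identityʳ _) (*-zeroʳ a))
  sum-linear {suc k} a f g = trans
    (cong (_+_ (a * f Fin.zero + g Fin.zero)) (sum-linear a (λ i → f (Fin.suc i)) (λ i → g (Fin.suc i))))
    (regroup a (f Fin.zero) (g Fin.zero) (sumℤ (λ i → f (Fin.suc i))) (sumℤ (λ i → g (Fin.suc i))))
    where
    regroup : ∀ a x y s t → a * x + y + (a * s + t) ≡ a * (x + s) + (y + t)
    regroup = solve-∀

  sum-+ : ∀ {k} (f g : Fin k → ℤ) → sumℤ (λ i → f i + g i) ≡ sumℤ f + sumℤ g
  sum-+ f g = begin
    sumℤ (λ i → f i + g i)        ≡⟨ sum-cong (λ i → cong (_+ g i) (sym (*-identityˡ (f i)))) ⟩
    sumℤ (λ i → 1ℤ * f i + g i)   ≡⟨ sum-linear 1ℤ f g ⟩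
    1ℤ * sumℤ f + sumℤ g          ≡⟨ cong (_+ sumℤ g) (*-identityˡ (sumℤ f)) ⟩
    sumℤ f + sumℤ g               ∎
    where open ≡-Reasoning

  *-distribˡ-sum : ∀ {k} a (f : Fin k → ℤ) → sumℤ (λ i → a * f i) ≡ a * sumℤ f
  *-distribˡ-sum {k} a f = begin
    sumℤ (λ i → a * f i)              ≡⟨ sum-cong (λ i → sym (+-identityʳ (a * f i))) ⟩
    sumℤ (λ i → a * f i + + 0)        ≡⟨ sum-linear a f (λ _ → + 0) ⟩
    a * sumℤ f + sumℤ {k} (λ _ → + 0) ≡⟨ cong (_+_ (a * sumℤ f)) (sum-zero k) ⟩
    a * sumℤ f + + 0                  ≡⟨ +-identityʳ _ ⟩
    a * sumℤ f                        ∎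
    where open ≡-Reasoning

  sum-swap : ∀ {k l} (f : Fin k → Fin l → ℤ) →
             sumℤ (λ i → sumℤ (λ j → f i j)) ≡ sumℤ (λ j → sumℤ (λ i → f i j))
  sum-swap {zero}  {l} f = sym (sum-zero l)
  sum-swap {suc k} f = trans
    (cong (_+_ (sumℤ (f Fin.zero))) (sum-swap (λ i → f (Fin.suc i))))
    (sym (sum-+ (f Fin.zero) (λ j → sumℤ (λ i → f (Fin.suc i) j))))

  indicator : ∀ {P : Set} → Dec P → ℤ → ℤ
  indicator (yes _) z = z
  indicator (no  _) z = + 0

  indicator-cong : ∀ {P Q : Set} (p? : Dec P) (q? : Dec Q) {y z : ℤ} →
                   (P → Q) → (Q → P) → (P → y ≡ z) → indicator p? y ≡ indicator q? z
  indicator-cong (yes p) (yes q) _   _   y≡z = y≡z p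
  indicator-cong (yes p) (no ¬q) p⇒q _   _   = contradiction (p⇒q p) ¬q
  indicator-cong (no ¬p) (yes q) _   q⇒p _   = contradiction (q⇒p q) ¬p
  indicator-cong (no ¬p) (no ¬q) _   _   _   = refl

  indicator-yes : ∀ {P : Set} (p? : Dec P) {z} → P → indicator p? z ≡ z
  indicator-yes (yes _) p = refl
  indicator-yes (no ¬p) p = contradiction p ¬p

  indicator-* : ∀ {P : Set} (p? : Dec P) y z → indicator p? y * z ≡ indicator p? (y * z)
  indicator-* (yes _) y z = refl
  indicator-* (no _)  y z = refl

  sum-indicator : ∀ {k} (x : Fin k) (f : Fin k → ℤ) → sumℤ (λ y → indicator (x Fin.≟ y) (f y)) ≡ f x
  sum-indicator {suc k} Fin.zero    f = begin
    f Fin.zero + sumℤ {k} (λ y → + 0)  ≡⟨ cong (_+_ (f Fin.zero)) (sum-zero k) ⟩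
    f Fin.zero + + 0                   ≡⟨ +-identityʳ _ ⟩
    f Fin.zero                         ∎
    where open ≡-Reasoning
  sum-indicator (Fin.suc x) f = begin
    + 0 + sumℤ (λ y → indicator (Fin.suc x Fin.≟ Fin.suc y) (f (Fin.suc y)))
      ≡⟨ +-identityˡ _ ⟩
    sumℤ (λ y → indicator (Fin.suc x Fin.≟ Fin.suc y) (f (Fin.suc y)))
      ≡⟨ sum-cong (λ y → indicator-cong (Fin.suc x Fin.≟ Fin.suc y) (x Fin.≟ y)
                           (λ { refl → refl }) (cong Fin.suc) (λ _ → refl)) ⟩
    sumℤ (λ y → indicator (x Fin.≟ y) (f (Fin.suc y)))
      ≡⟨ sum-indicator x (λ y → f (Fin.suc y)) ⟩
    f (Fin.suc x) ∎
    where open ≡-Reasoning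

  -- Parity as the ring homomorphism from ℤ to 𝔽₂

  ⟦_⟧ : Bool → ℤ
  ⟦ true ⟧  = + 1
  ⟦ false ⟧ = + 0

  -- Unlike `parity`, which goes through a remainder, this form recurses by two and so admits
  -- structural induction.
  parityℕ : ℕ → Bool
  parityℕ zero          = false
  parityℕ (suc zero)    = true
  parityℕ (suc (suc n)) = parityℕ n

  parity-abs : ∀ z → parity z ≡ parityℕ ∣ z ∣
  parity-abs z with ∣ z ∣
  ... | n = go n
    where
    go : ∀ n → parity (+ n) ≡ parityℕ n
    go zero          = refl
    go (suc zero)    = refl
    go (suc (suc n)) = trans (drop-two n) (go n)
      where
      drop-two : ∀ n → parity (+ suc (suc n)) ≡ parity (+ n)
      drop-two n rewrite trans (cong (ℕ._% 2) (ℕ.+-comm 2 n)) ([m+kn]%n≡m%n n 1 2) = refl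

  xor-cancel : ∀ a b → (a xor b) xor b ≡ a
  xor-cancel true  true  = refl
  xor-cancel true  false = refl
  xor-cancel false true  = refl
  xor-cancel false false = refl

  parity-suc : ∀ z → parity (1ℤ + z) ≡ true xor parity z
  parity-suc z = trans (parity-abs (1ℤ + z)) (trans (go z) (cong (true xor_) (sym (parity-abs z))))
    where
    parityℕ-suc : ∀ n → parityℕ (suc n) ≡ true xor parityℕ n
    parityℕ-suc zero          = refl
    parityℕ-suc (suc zero)    = refl
    parityℕ-suc (suc (suc n)) = parityℕ-suc n

    go : ∀ z → parityℕ ∣ 1ℤ + z ∣ ≡ true xor parityℕ ∣ z ∣
    go (+ n)            = parityℕ-suc n
    go -[1+ zero ]      = refl
    go -[1+ suc n ]     = sym (trans (cong (true xor_) (parityℕ-suc (suc n))) (flip-flip (parityℕ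
        (suc n))))
      where
      flip-flip : ∀ b → true xor (true xor b) ≡ b
      flip-flip true  = refl
      flip-flip false = refl

  parity-+ : ∀ x y → parity (x + y) ≡ parity x xor parity y
  parity-+ x y = go x y
    where
    open ≡-Reasoning

    nonNegative : ∀ n y → parity (+ n + y) ≡ parity (+ n) xor parity y
    nonNegative zero    y = cong parity (+-identityˡ y)
    nonNegative (suc n) y = begin
      parity (+ suc n + y)                 ≡⟨ cong parity (+-assoc 1ℤ (+ n) y) ⟩
      parity (1ℤ + (+ n + y))              ≡⟨ parity-suc (+ n + y) ⟩
      true xor parity (+ n + y)            ≡⟨ cong (true xor_) (nonNegative n y) ⟩
      true xor (parity (+ n) xor parity y) ≡⟨ xor-assoc true (parity (+ n)) (parity y) ⟨
      (true xor parity (+ n)) xor parity y ≡⟨ cong (_xor parity y) (parity-suc (+ n)) ⟨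
      parity (+ suc n) xor parity y        ∎

    cancel : ∀ x y → x + (- x + y) ≡ y
    cancel = solve-∀

    go : ∀ x y → parity (x + y) ≡ parity x xor parity y
    go (+ n)      y = nonNegative n y
    -- Here `- x` is nonnegative and y = - x + (x + y), so the previous case applies to that sum.
    -- `parity x` and `parity (- x)` coincide by computation, as only the absolute value matters.
    go x@(-[1+ n ]) y = begin
      parity (x + y)                            ≡⟨ xor-cancel (parity (x + y)) (parity (- x)) ⟨
      (parity (x + y) xor parity (- x)) xor parity (- x)
        ≡⟨ cong (_xor parity (- x)) (xor-comm (parity (x + y)) (parity (- x))) ⟩
      (parity (- x) xor parity (x + y)) xor parity (- x)
        ≡⟨ cong (_xor parity (- x)) (nonNegative (suc n) (x + y)) ⟨
      parity (- x + (x + y)) xor parity (- x)   ≡⟨ cong (λ z → parity z xor parity (- x)) (cancel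
          (- x) y) ⟩
      parity y xor parity (- x)                 ≡⟨ xor-comm (parity y) (parity (- x)) ⟩
      parity (- x) xor parity y                 ∎

  parity-* : ∀ x y → parity (x * y) ≡ parity x ∧ parity y
  parity-* x y = trans (parity-abs (x * y)) (trans (cong parityℕ (abs-* x y)) (trans (go ∣ x ∣)
    (cong₂ _∧_ (sym (parity-abs x)) (sym (parity-abs y)))))
    where
    n = ∣ y ∣
    parityℕ-+ : ∀ m n → parityℕ (m ℕ.+ n) ≡ parityℕ m xor parityℕ n
    parityℕ-+ m n = trans (sym (parity-abs (+ (m ℕ.+ n)))) (trans (parity-+ (+ m) (+ n)) (cong₂ _xor_
        (parity-abs (+ m)) (parity-abs (+ n))))
    cancel : ∀ a b → a xor (a xor b) ≡ b
    cancel true  true  = refl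
    cancel true  false = refl
    cancel false b = refl
    go : ∀ m → parityℕ (m ℕ.* n) ≡ parityℕ m ∧ parityℕ n
    go zero          = refl
    go (suc zero)    = cong parityℕ (ℕ.+-identityʳ n)
    go (suc (suc m)) = trans (parityℕ-+ n (n ℕ.+ m ℕ.* n)) (trans (cong (parityℕ n xor_) (parityℕ-+ n
        (m ℕ.* n)))
      (trans (cancel (parityℕ n) (parityℕ (m ℕ.* n))) (go m)))

  parity-sum : ∀ {k} (f : Fin k → ℤ) → parity (sumℤ f) ≡ sumF₂ (λ i → parity (f i))
  parity-sum {zero}  f = refl
  parity-sum {suc k} f = trans (parity-+ (f Fin.zero) _) (cong (parity (f Fin.zero) xor_) (parity-sum
      (λ i → f (Fin.suc i))))

  sumF₂-cong : ∀ {k} {f g : Fin k → Bool} → (∀ i → f i ≡ g i) → sumF₂ f ≡ sumF₂ g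
  sumF₂-cong {zero}  f≗g = refl
  sumF₂-cong {suc k} f≗g = cong₂ _xor_ (f≗g Fin.zero) (sumF₂-cong (λ i → f≗g (Fin.suc i)))

  parity-⟦⟧ : ∀ b → parity ⟦ b ⟧ ≡ b
  parity-⟦⟧ true  = refl
  parity-⟦⟧ false = refl

  halve : ∀ z → ∃ λ w → z ≡ + 2 * w ⊎ z ≡ + 2 * w + 1ℤ
  halve z with z %ℕ 2 in eq | n%ℕd<d z 2 | a≡a%ℕn+[a/ℕn]*n z 2
  ... | zero        | _ | z≡ = z /ℕ 2 , inj₁ (trans z≡ (trans (+-identityˡ _) (*-comm (z /ℕ 2) (+ 2))))
  ... | suc zero    | _ | z≡ = z /ℕ 2 , inj₂ (trans z≡ (trans (+-comm 1ℤ (z /ℕ 2 * + 2)) (cong (_+ 1ℤ)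
      (*-comm (z /ℕ 2) (+ 2)))))
  ... | suc (suc _) | ℕ.s≤s (ℕ.s≤s ()) | _

  parity-double : ∀ w → parity (+ 2 * w) ≡ false
  parity-double w = parity-* (+ 2) w

  even⇒double : ∀ z → parity z ≡ false → ∃ λ w → z ≡ + 2 * w
  even⇒double z even with halve z
  ... | w , inj₁ z≡ = w , z≡
  ... | w , inj₂ z≡ = contradiction
    (trans (sym even) (trans (cong parity z≡) (trans (parity-+ (+ 2 * w) 1ℤ) (cong (_xor true)
        (parity-double w))))) (λ ())

  odd⇒double+1 : ∀ z → parity z ≡ true → ∃ λ w → z ≡ + 2 * w + 1ℤ
  odd⇒double+1 z odd with halve z
  ... | w , inj₁ z≡ = contradiction (trans (sym odd) (trans (cong parity z≡) (parity-double w))) (λ ())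
  ... | w , inj₂ z≡ = w , z≡

  -- Diagonalisation over ℤ

  infixl 6 _⊕_
  infixr 7 _⋆_

  _⊕_ : ∀ {n} → Vec ℤ n → Vec ℤ n → Vec ℤ n
  _⊕_ = zipWith _+_

  _⋆_ : ∀ {n} → ℤ → Vec ℤ n → Vec ℤ n
  a ⋆ x = map (a *_) x

  𝟘 : ∀ {n} → Vec ℤ n
  𝟘 = replicate _ 0ℤ

  vec-ext : ∀ {n} {x y : Vec ℤ n} → (∀ i → lookup x i ≡ lookup y i) → x ≡ y
  vec-ext {x = x} {y} x≗y = trans (sym (tabulate∘lookup x)) (trans (tabulate-cong x≗y)
      (tabulate∘lookup y))

  lookup-⊕ : ∀ {n} (x y : Vec ℤ n) i → lookup (x ⊕ y) i ≡ lookup x i + lookup y i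
  lookup-⊕ x y i = lookup-zipWith _+_ i x y

  lookup-⋆ : ∀ {n} a (x : Vec ℤ n) i → lookup (a ⋆ x) i ≡ a * lookup x i
  lookup-⋆ a x i = lookup-map i (a *_) x

  lookup-⋆⊕ : ∀ {n} a (x y : Vec ℤ n) i → lookup (a ⋆ x ⊕ y) i ≡ a * lookup x i + lookup y i
  lookup-⋆⊕ a x y i = trans (lookup-⊕ (a ⋆ x) y i) (cong (λ z → z + lookup y i) (lookup-⋆ a x i))

  ⋆⊕𝟘 : ∀ {n} a (x : Vec ℤ n) → a ⋆ x ⊕ 𝟘 ≡ a ⋆ x
  ⋆⊕𝟘 a []      = refl
  ⋆⊕𝟘 a (z ∷ x) = cong₂ _∷_ (+-identityʳ (a * z)) (⋆⊕𝟘 a x)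

  ⋆𝟘⊕ : ∀ {n} a (x : Vec ℤ n) → a ⋆ 𝟘 ⊕ x ≡ x
  ⋆𝟘⊕ a []      = refl
  ⋆𝟘⊕ a (z ∷ x) = cong₂ _∷_ (trans (cong (λ w → w + z) (*-zeroʳ a)) (+-identityˡ z)) (⋆𝟘⊕ a x)

  -- One equation in a, x, y covers additivity and homogeneity. Vectors are `Vec` here, not
  -- functions, so that entrywise equality yields `≡` through `vec-ext`.
  Linear : ∀ {m n} → (Vec ℤ m → Vec ℤ n) → Set
  Linear f = ∀ a x y → f (a ⋆ x ⊕ y) ≡ a ⋆ f x ⊕ f y

  LinearForm : ∀ {n} → (Vec ℤ n → ℤ) → Set
  LinearForm φ = ∀ a x y → φ (a ⋆ x ⊕ y) ≡ a * φ x + φ y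

  ∘-linear : ∀ {l m n} {f : Vec ℤ m → Vec ℤ n} {g : Vec ℤ l → Vec ℤ m} →
             Linear f → Linear g → Linear (f ∘ g)
  ∘-linear {f = f} {g} f-lin g-lin a x y = trans (cong f (g-lin a x y)) (f-lin a (g x) (g y))

  head-linear : ∀ {m n} {f : Vec ℤ m → Vec ℤ (suc n)} → Linear f → LinearForm (head ∘ f)
  head-linear {f = f} f-lin a x y = trans (cong head (f-lin a x y)) (go (f x) (f y))
    where
    go : ∀ u w → head (a ⋆ u ⊕ w) ≡ a * head u + head w
    go (_ ∷ _) (_ ∷ _) = refl

  tail-linear : ∀ {m n} {f : Vec ℤ m → Vec ℤ (suc n)} → Linear f → Linear (tail ∘ f)
  tail-linear {f = f} f-lin a x y = trans (cong tail (f-lin a x y)) (go (f x) (f y))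
    where
    go : ∀ u w → tail (a ⋆ u ⊕ w) ≡ a ⋆ tail u ⊕ tail w
    go (_ ∷ _) (_ ∷ _) = refl

  0∷-linear : ∀ {n} → Linear {n} (0ℤ ∷_)
  0∷-linear a x y = cong (_∷ a ⋆ x ⊕ y) (sym (trans (+-identityʳ (a * 0ℤ)) (*-zeroʳ a)))

  form-𝟘 : ∀ {n} {φ : Vec ℤ n → ℤ} → LinearForm φ → φ 𝟘 ≡ 0ℤ
  form-𝟘 {φ = φ} φ-lin = begin
    φ 𝟘                   ≡⟨ cong φ (⋆𝟘⊕ (- 1ℤ) 𝟘) ⟨
    φ (- 1ℤ ⋆ 𝟘 ⊕ 𝟘)      ≡⟨ φ-lin (- 1ℤ) 𝟘 𝟘 ⟩
    - 1ℤ * φ 𝟘 + φ 𝟘      ≡⟨ cancel (φ 𝟘) ⟩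
    0ℤ                    ∎
    where
    open ≡-Reasoning
    cancel : ∀ z → - 1ℤ * z + z ≡ 0ℤ
    cancel = solve-∀

  linear-𝟘 : ∀ {m n} {f : Vec ℤ m → Vec ℤ n} → Linear f → f 𝟘 ≡ 𝟘
  linear-𝟘 {f = f} f-lin = vec-ext λ i → trans
    (form-𝟘 {φ = λ x → lookup (f x) i}
      (λ a x y → trans (cong (λ u → lookup u i) (f-lin a x y)) (lookup-⋆⊕ a (f x) (f y) i)))
    (sym (lookup-replicate i 0ℤ))

  linear-⋆ : ∀ {m n} {f : Vec ℤ m → Vec ℤ n} → Linear f → ∀ a x → f (a ⋆ x) ≡ a ⋆ f x
  linear-⋆ {f = f} f-lin a x = begin
    f (a ⋆ x)          ≡⟨ cong f (⋆⊕𝟘 a x) ⟨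
    f (a ⋆ x ⊕ 𝟘)      ≡⟨ f-lin a x 𝟘 ⟩
    a ⋆ f x ⊕ f 𝟘      ≡⟨ cong (λ u → a ⋆ f x ⊕ u) (linear-𝟘 {f = f} f-lin) ⟩
    a ⋆ f x ⊕ 𝟘        ≡⟨ ⋆⊕𝟘 a (f x) ⟩
    a ⋆ f x            ∎
    where open ≡-Reasoning

  ∷-split : ∀ {n} y₀ (y : Vec ℤ n) → y₀ ∷ y ≡ y₀ ⋆ (1ℤ ∷ 𝟘) ⊕ (0ℤ ∷ y)
  ∷-split y₀ y = cong₂ _∷_ (sym (trans (+-identityʳ (y₀ * 1ℤ)) (*-identityʳ y₀))) (sym (⋆𝟘⊕ y₀ y))

  -- An element of GL(n , ℤ), given together with its inverse instead of by a determinant condition.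
  record Aut (n : ℕ) : Set where
    field
      to from : Vec ℤ n → Vec ℤ n
      linear  : Linear to
      from-to : ∀ x → from (to x) ≡ x
      to-from : ∀ x → to (from x) ≡ x

    from-linear : Linear from
    from-linear a x y = begin
      from (a ⋆ x ⊕ y)                     ≡⟨ cong₂ (λ u w → from (a ⋆ u ⊕ w)) (to-from x) (to-from y) ⟨
      from (a ⋆ to (from x) ⊕ to (from y)) ≡⟨ cong from (linear a (from x) (from y)) ⟨
      from (to (a ⋆ from x ⊕ from y))      ≡⟨ from-to _ ⟩
      a ⋆ from x ⊕ from y                  ∎
      where open ≡-Reasoning

  open Aut

  idᴬ : ∀ {n} → Aut n
  idᴬ = record { to = λ x → x ; from = λ x → x ; linear = λ _ _ _ → refl
               ; from-to = λ _ → refl ; to-from = λ _ → refl }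

  _⁻¹ᴬ : ∀ {n} → Aut n → Aut n
  U ⁻¹ᴬ = record { to = from U ; from = to U ; linear = from-linear U
                 ; from-to = to-from U ; to-from = from-to U }

  _∘ᴬ_ : ∀ {n} → Aut n → Aut n → Aut n
  U ∘ᴬ V = record
    { to      = λ x → to U (to V x)
    ; from    = λ x → from V (from U x)
    ; linear  = ∘-linear {f = to U} {to V} (linear U) (linear V)
    ; from-to = λ x → trans (cong (from V) (from-to U (to V x))) (from-to V x)
    ; to-from = λ x → trans (cong (to U) (to-from V (from U x))) (to-from U x)
    }

  keepHead : ∀ {n} → Aut n → Aut (suc n)
  keepHead U = record
    { to      = λ { (x₀ ∷ x) → x₀ ∷ to U x }
    ; from    = λ { (x₀ ∷ x) → x₀ ∷ from U x }
    ; linear  = λ { a (x₀ ∷ x) (y₀ ∷ y) → cong (a * x₀ + y₀ ∷_) (linear U a x y) }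
    ; from-to = λ { (x₀ ∷ x) → cong (x₀ ∷_) (from-to U x) }
    ; to-from = λ { (x₀ ∷ x) → cong (x₀ ∷_) (to-from U x) }
    }

  swap : ∀ {n} → Aut (suc (suc n))
  swap = record
    { to      = λ { (x₀ ∷ x₁ ∷ x) → x₁ ∷ x₀ ∷ x }
    ; from    = λ { (x₀ ∷ x₁ ∷ x) → x₁ ∷ x₀ ∷ x }
    ; linear  = λ { a (x₀ ∷ x₁ ∷ x) (y₀ ∷ y₁ ∷ y) → refl }
    ; from-to = λ { (x₀ ∷ x₁ ∷ x) → refl }
    ; to-from = λ { (x₀ ∷ x₁ ∷ x) → refl }
    }

  shear : ∀ {n} → Vec ℤ n → Aut (suc n)
  shear {n} t = record
    { to      = λ { (x₀ ∷ x) → x₀ ∷ (- x₀) ⋆ t ⊕ x }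
    ; from    = λ { (x₀ ∷ x) → x₀ ∷ x₀ ⋆ t ⊕ x }
    ; linear  = λ { a (x₀ ∷ x) (y₀ ∷ y) → cong (a * x₀ + y₀ ∷_) (shear-linear a x₀ y₀ t x y) }
    ; from-to = λ { (x₀ ∷ x) → cong (x₀ ∷_) (cancel x₀ t x) }
    ; to-from = λ { (x₀ ∷ x) → cong (x₀ ∷_) (cancel′ x₀ t x) }
    }
    where
    shear-linear : ∀ {n} a x₀ y₀ (t x y : Vec ℤ n) →
      (- (a * x₀ + y₀)) ⋆ t ⊕ (a ⋆ x ⊕ y) ≡ a ⋆ ((- x₀) ⋆ t ⊕ x) ⊕ ((- y₀) ⋆ t ⊕ y)
    shear-linear a x₀ y₀ []      []      []      = refl
    shear-linear a x₀ y₀ (s ∷ t) (p ∷ x) (q ∷ y) = cong₂ _∷_ (entry a x₀ y₀ s p q)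
        (shear-linear a x₀ y₀ t x y)
      where
      entry : ∀ a x₀ y₀ s p q → (- (a * x₀ + y₀)) * s + (a * p + q) ≡ a * ((- x₀) * s + p) +
          ((- y₀) * s + q)
      entry = solve-∀

    cancel : ∀ {n} z (t x : Vec ℤ n) → z ⋆ t ⊕ ((- z) ⋆ t ⊕ x) ≡ x
    cancel z []      []      = refl
    cancel z (s ∷ t) (p ∷ x) = cong₂ _∷_ (entry z s p) (cancel z t x)
      where
      entry : ∀ z s p → z * s + ((- z) * s + p) ≡ p
      entry = solve-∀

    cancel′ : ∀ {n} z (t x : Vec ℤ n) → (- z) ⋆ t ⊕ (z ⋆ t ⊕ x) ≡ x
    cancel′ z []      []      = refl
    cancel′ z (s ∷ t) (p ∷ x) = cong₂ _∷_ (entry z s p) (cancel′ z t x)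
      where
      entry : ∀ z s p → (- z) * s + (z * s + p) ≡ p
      entry = solve-∀

  -- A division step followed by a swap: the remainder lands in front, where the next step expects
  -- it.
  euclidStep : ∀ {n} → ℤ → Aut (suc (suc n))
  euclidStep q = record
    { to      = λ { (x₀ ∷ x₁ ∷ x) → x₁ + (- q) * x₀ ∷ x₀ ∷ x }
    ; from    = λ { (x₀ ∷ x₁ ∷ x) → x₁ ∷ x₀ + q * x₁ ∷ x }
    ; linear  = λ { a (x₀ ∷ x₁ ∷ x) (y₀ ∷ y₁ ∷ y) →
                    cong (λ z → z ∷ a * x₀ + y₀ ∷ a ⋆ x ⊕ y) (lin a q x₀ x₁ y₀ y₁) }
    ; from-to = λ { (x₀ ∷ x₁ ∷ x) → cong (λ z → x₀ ∷ z ∷ x) (cancel q x₀ x₁) }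
    ; to-from = λ { (x₀ ∷ x₁ ∷ x) → cong (λ z → z ∷ x₁ ∷ x) (cancel′ q x₀ x₁) }
    }
    where
    lin : ∀ a q x₀ x₁ y₀ y₁ →
      a * x₁ + y₁ + (- q) * (a * x₀ + y₀) ≡ a * (x₁ + (- q) * x₀) + (y₁ + (- q) * y₀)
    lin = solve-∀
    cancel : ∀ q x₀ x₁ → x₁ + (- q) * x₀ + q * x₀ ≡ x₁
    cancel = solve-∀
    cancel′ : ∀ q x₀ x₁ → x₀ + q * x₁ + (- q) * x₁ ≡ x₀
    cancel′ = solve-∀

  combine₂ : ∀ {n} → ℤ → ℤ → Vec ℤ (suc (suc n)) → ℤ
  combine₂ a d (y₀ ∷ y₁ ∷ _) = a * y₀ + d * y₁

  -- Euclid's algorithm on the coefficients of a form in two variables; g is their gcd up to sign.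
  -- Precomposing with the inverse of `euclidStep (- q)`, which sends (z₀ , z₁) to (z₁ , z₀ - q z₁),
  -- replaces the coefficients (a , d) by (d , a mod d).
  gcdReduce : ∀ {n} a d → Acc ℕ._<_ ∣ d ∣ →
              ∃₂ λ g (W : Aut (suc (suc n))) → ∀ z → combine₂ a d (to W z) ≡ g * head z
  gcdReduce {n} a d (acc rec) with d ≟ 0ℤ
  ... | yes refl = a , idᴬ , λ { (z₀ ∷ z₁ ∷ z) → +-identityʳ (a * z₀) }
  ... | no d≢0 with gcdReduce {n} d (+ ρ) (rec (n%d<d a d {{≢-nonZero d≢0}}))
    where ρ = _%_ a d {{≢-nonZero d≢0}}
  ... | g , W , W-reduces = g , ((euclidStep (- q) ⁻¹ᴬ) ∘ᴬ W) , λ z → trans (divide (to W z))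
      (W-reduces z)
    where
    instance _ = ≢-nonZero d≢0
    q = a / d
    regroup : ∀ d q ρ z₀ z₁ → (ρ + q * d) * z₁ + d * (z₀ + (- q) * z₁) ≡ d * z₀ + ρ * z₁
    regroup = solve-∀
    divide : ∀ z → combine₂ a d (from (euclidStep (- q)) z) ≡ combine₂ d (+ (a % d)) z
    divide (z₀ ∷ z₁ ∷ z) = trans
      (cong (λ w → w * z₁ + d * (z₀ + (- q) * z₁)) (a≡a%n+[a/n]*n a d))
      (regroup d q (+ (a % d)) z₀ z₁)

  -- Column operations that clear a whole row: by induction the form on the tail becomes d times one
  -- coordinate, and Euclid's algorithm merges d with the leading coefficient.
  formReduce : ∀ {n} (φ : Vec ℤ (suc n) → ℤ) → LinearForm φ →
               ∃₂ λ d (V : Aut (suc n)) → ∀ y → φ (to V y) ≡ d * head y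
  formReduce {zero} φ φ-lin = φ (1ℤ ∷ []) , idᴬ , λ { (y₀ ∷ []) → scale y₀ }
    where
    open ≡-Reasoning
    scale : ∀ y₀ → φ (y₀ ∷ []) ≡ φ (1ℤ ∷ []) * y₀
    scale y₀ = begin
      φ (y₀ ∷ [])                          ≡⟨ cong φ (∷-split y₀ []) ⟩
      φ (y₀ ⋆ (1ℤ ∷ []) ⊕ 𝟘)               ≡⟨ φ-lin y₀ (1ℤ ∷ []) 𝟘 ⟩
      y₀ * φ (1ℤ ∷ []) + φ 𝟘               ≡⟨ cong (λ z → y₀ * φ (1ℤ ∷ []) + z) (form-𝟘 φ-lin) ⟩
      y₀ * φ (1ℤ ∷ []) + 0ℤ                ≡⟨ +-identityʳ (y₀ * φ (1ℤ ∷ [])) ⟩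
      y₀ * φ (1ℤ ∷ [])                     ≡⟨ *-comm y₀ (φ (1ℤ ∷ [])) ⟩
      φ (1ℤ ∷ []) * y₀                     ∎
  formReduce {suc n} φ φ-lin
    with formReduce (λ y → φ (0ℤ ∷ y))
           (λ a x y → trans (cong φ (0∷-linear a x y)) (φ-lin a (0ℤ ∷ x) (0ℤ ∷ y)))
  ... | d , V , V-reduces with gcdReduce {n} (φ (1ℤ ∷ 𝟘)) d (<-wellFounded ∣ d ∣)
  ... | g , W , W-reduces = g , (keepHead V ∘ᴬ W) , λ y → trans (split (to W y)) (W-reduces y)
    where
    open ≡-Reasoning
    split : ∀ y → φ (to (keepHead V) y) ≡ combine₂ (φ (1ℤ ∷ 𝟘)) d y
    split (y₀ ∷ y₁ ∷ y) = begin
      φ (y₀ ∷ V[y])                       ≡⟨ cong φ (∷-split y₀ V[y]) ⟩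
      φ (y₀ ⋆ (1ℤ ∷ 𝟘) ⊕ (0ℤ ∷ V[y]))     ≡⟨ φ-lin y₀ (1ℤ ∷ 𝟘) (0ℤ ∷ V[y]) ⟩
      y₀ * φ (1ℤ ∷ 𝟘) + φ (0ℤ ∷ V[y])     ≡⟨ cong₂ _+_ (*-comm y₀ (φ (1ℤ ∷ 𝟘))) (V-reduces (y₁ ∷ y)) ⟩
      φ (1ℤ ∷ 𝟘) * y₀ + d * y₁            ∎
      where V[y] = to V (y₁ ∷ y)

  -- Row operations on the column (d , w): either d divides everything below it, so that a shear
  -- will clear the column, or some nonzero remainder mod d can be moved to the front as a strictly
  -- smaller candidate for the pivot.
  columnReduce : ∀ {n} d (w : Vec ℤ n) → NonZero d →
    (∃ λ t → w ≡ d ⋆ t) ⊎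
    (∃ λ (U : Aut (suc n)) → head (to U (d ∷ w)) ≢ 0ℤ × ∣ head (to U (d ∷ w)) ∣ ℕ.< ∣ d ∣)
  columnReduce d []       d≢0 = inj₁ ([] , refl)
  columnReduce d (w₀ ∷ w) d≢0 with + (_%_ w₀ d {{d≢0}}) ≟ 0ℤ | columnReduce d w d≢0
  ... | no ρ≢0 | _ = inj₂ (euclidStep q , subst (_≢ 0ℤ) (sym entry) ρ≢0
                          , subst (λ z → ∣ z ∣ ℕ.< ∣ d ∣) (sym entry) (n%d<d w₀ d {{d≢0}}))
    where
    instance _ = d≢0
    q = w₀ / d
    cancel : ∀ ρ q d → ρ + q * d + (- q) * d ≡ ρ
    cancel = solve-∀
    entry : w₀ + (- q) * d ≡ + (w₀ % d)
    entry = trans (cong (λ z → z + (- q) * d) (a≡a%n+[a/n]*n w₀ d)) (cancel (+ (w₀ % d)) q d)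
  ... | yes ρ≡0 | inj₁ (t , w≡dt) = inj₁ (q ∷ t , cong₂ _∷_ entry w≡dt)
    where
    instance _ = d≢0
    q = w₀ / d
    open ≡-Reasoning
    entry : w₀ ≡ d * q
    entry = begin
      w₀                  ≡⟨ a≡a%n+[a/n]*n w₀ d ⟩
      + (w₀ % d) + q * d  ≡⟨ cong (λ z → z + q * d) ρ≡0 ⟩
      0ℤ + q * d          ≡⟨ +-identityˡ (q * d) ⟩
      q * d               ≡⟨ *-comm q d ⟩
      d * q               ∎
  ... | yes _ | inj₂ (U , nz , lt) =
    -- The operation found for (d , w) must skip the entry w₀: conjugation with `swap` parks w₀ in
    -- front while `U` acts on the rest.
    inj₂ (swap ∘ᴬ (keepHead U ∘ᴬ swap) , subst (_≢ 0ℤ) (sym entry) nz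
         , subst (λ z → ∣ z ∣ ℕ.< ∣ d ∣) (sym entry) lt)
    where
    entry : head (to swap (w₀ ∷ to U (d ∷ w))) ≡ head (to U (d ∷ w))
    entry with to U (d ∷ w)
    ... | _ ∷ _ = refl

  record Pivot {n : ℕ} (B : Vec ℤ (suc n) → Vec ℤ (suc n)) : Set where
    field
      U V      : Aut (suc n)
      d        : ℤ
      B′       : Vec ℤ n → Vec ℤ n
      B′-lin   : Linear B′
      pivoted  : ∀ y₀ y → to U (B (to V (y₀ ∷ y))) ≡ d * y₀ ∷ B′ y

  pivot-∘ : ∀ {n} {B : Vec ℤ (suc n) → Vec ℤ (suc n)} (U V : Aut (suc n)) →
            Pivot (to U ∘ B ∘ to V) → Pivot B
  pivot-∘ U V P = record
    { U = Pivot.U P ∘ᴬ U ; V = V ∘ᴬ Pivot.V P ; d = Pivot.d P ; B′ = Pivot.B′ P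
    ; B′-lin = Pivot.B′-lin P ; pivoted = Pivot.pivoted P }

  head-tail : ∀ {n} (x : Vec ℤ (suc n)) → x ≡ head x ∷ tail x
  head-tail (_ ∷ _) = refl

  ∣-abs-≤ : ∀ {g z} w → z ≢ 0ℤ → z ≡ g * w → g ≢ 0ℤ × ∣ g ∣ ℕ.≤ ∣ z ∣
  ∣-abs-≤ {g} {z} w z≢0 z≡gw = (λ { refl → z≢0 z≡gw }) , subst (∣ g ∣ ℕ.≤_) (sym (trans
      (cong ∣_∣ z≡gw) (abs-* g w)))
    (ℕ.m≤m*n ∣ g ∣ ∣ w ∣ {{≢-nonZero {w} λ { refl → z≢0 (trans z≡gw (*-zeroʳ g)) }}})

  -- The first row is already (d , 0 , ... , 0). If d divides the first column, a shear clears it.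
  -- Otherwise a row operation produces a smaller corner entry but spoils the row; clearing the row
  -- again gives a pivot g that divides this entry, so the absolute value of the pivot drops and the
  -- process stops.
  pivotise : ∀ {n} (B : Vec ℤ (suc n) → Vec ℤ (suc n)) → Linear B → ∀ d → d ≢ 0ℤ →
             (∀ y → head (B y) ≡ d * head y) → Acc ℕ._<_ ∣ d ∣ → Pivot B
  pivotise {n} B B-lin d d≢0 row (acc rec)
    with columnReduce d (tail (B (1ℤ ∷ 𝟘))) (≢-nonZero d≢0)
  ... | inj₁ (t , w≡dt) = record
    { U = shear t ; V = idᴬ ; d = d ; B′ = λ y → tail (B (0ℤ ∷ y))
    ; B′-lin = tail-linear {f = λ y → B (0ℤ ∷ y)} (∘-linear {f = B} {0ℤ ∷_} B-lin 0∷-linear)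
    ; pivoted = pivoted }
    where
    open ≡-Reasoning
    cancel : ∀ {m} y₀ (t x : Vec ℤ m) → (- (d * y₀)) ⋆ t ⊕ (y₀ ⋆ (d ⋆ t) ⊕ x) ≡ x
    cancel y₀ []      []      = refl
    cancel y₀ (s ∷ t) (p ∷ x) = cong₂ _∷_ (entry d y₀ s p) (cancel y₀ t x)
      where
      entry : ∀ d y₀ s p → (- (d * y₀)) * s + (y₀ * (d * s) + p) ≡ p
      entry = solve-∀
    column : ∀ y₀ y → tail (B (y₀ ∷ y)) ≡ y₀ ⋆ (d ⋆ t) ⊕ tail (B (0ℤ ∷ y))
    column y₀ y = begin
      tail (B (y₀ ∷ y))                                     ≡⟨ cong (tail ∘ B) (∷-split y₀ y) ⟩
      tail (B (y₀ ⋆ (1ℤ ∷ 𝟘) ⊕ (0ℤ ∷ y)))                   ≡⟨ tail-linear {f = B} B-lin y₀ (1ℤ ∷ 𝟘)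
          (0ℤ ∷ y) ⟩
      y₀ ⋆ tail (B (1ℤ ∷ 𝟘)) ⊕ tail (B (0ℤ ∷ y))            ≡⟨ cong (λ u → y₀ ⋆ u ⊕ tail (B
          (0ℤ ∷ y))) w≡dt ⟩
      y₀ ⋆ (d ⋆ t) ⊕ tail (B (0ℤ ∷ y))                      ∎
    pivoted : ∀ y₀ y → to (shear t) (B (y₀ ∷ y)) ≡ d * y₀ ∷ tail (B (0ℤ ∷ y))
    pivoted y₀ y = begin
      to (shear t) (B (y₀ ∷ y))
        ≡⟨ cong (to (shear t)) (trans (head-tail (B (y₀ ∷ y))) (cong₂ _∷_ (row (y₀ ∷ y)) (column y₀ y))) ⟩
      d * y₀ ∷ (- (d * y₀)) ⋆ t ⊕ (y₀ ⋆ (d ⋆ t) ⊕ tail (B (0ℤ ∷ y)))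
        ≡⟨ cong (d * y₀ ∷_) (cancel y₀ t _) ⟩
      d * y₀ ∷ tail (B (0ℤ ∷ y))  ∎
  ... | inj₂ (U , ρ≢0 , ρ<d)
    with formReduce (head ∘ to U ∘ B) (head-linear {f = to U ∘ B} (∘-linear {f = to U} {B}
        (linear U) B-lin))
  ... | g , V , V-reduces = pivot-∘ U V
    (pivotise (to U ∘ B ∘ to V)
              (∘-linear {f = to U} {B ∘ to V} (linear U) (∘-linear {f = B} {to V} B-lin (linear V)))
              g (proj₁ g-small) V-reduces (rec (ℕ.≤-<-trans (proj₂ g-small) ρ<d)))
    where
    open ≡-Reasoning
    w = tail (B (1ℤ ∷ 𝟘))
    -- The new corner entry is a value of the form that was reduced to g times a coordinate, hence a
    -- multiple of g.
    multiple : head (to U (d ∷ w)) ≡ g * head (from V (1ℤ ∷ 𝟘))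
    multiple = begin
      head (to U (d ∷ w))
        ≡⟨ cong (λ z → head (to U (z ∷ w))) (trans (row (1ℤ ∷ 𝟘)) (*-identityʳ d)) ⟨
      head (to U (head (B (1ℤ ∷ 𝟘)) ∷ w))         ≡⟨ cong (head ∘ to U) (head-tail (B (1ℤ ∷ 𝟘))) ⟨
      head (to U (B (1ℤ ∷ 𝟘)))                    ≡⟨ cong (head ∘ to U ∘ B) (to-from V (1ℤ ∷ 𝟘)) ⟨
      head (to U (B (to V (from V (1ℤ ∷ 𝟘)))))    ≡⟨ V-reduces (from V (1ℤ ∷ 𝟘)) ⟩
      g * head (from V (1ℤ ∷ 𝟘))                  ∎
    g-small = ∣-abs-≤ (head (from V (1ℤ ∷ 𝟘))) ρ≢0 multiple

  pivot : ∀ {n} (B : Vec ℤ (suc n) → Vec ℤ (suc n)) → Linear B → (∃ λ y → head (B y) ≢ 0ℤ) → Pivot B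
  pivot B B-lin (y , By≢0) with formReduce (head ∘ B) (head-linear {f = B} B-lin)
  ... | d , V , V-reduces = pivot-∘ idᴬ V
    (pivotise (B ∘ to V) (∘-linear {f = B} {to V} B-lin (linear V)) d d≢0 V-reduces (<-wellFounded ∣ d ∣))
    where
    d≢0 : d ≢ 0ℤ
    d≢0 refl = By≢0 (trans (sym (cong (head ∘ B) (to-from V y))) (V-reduces (from V y)))

  -- Here `V` gives coordinates on the source, so the equation reads U B V⁻¹ = diag(d); it is
  -- inverse to the `V` of `Pivot`.
  record Diagonal {n : ℕ} (B : Vec ℤ n → Vec ℤ n) : Set where
    field
      U V      : Aut n
      d        : Fin n → ℤ
      diagonal : ∀ y i → lookup (to U (B y)) i ≡ d i * lookup (to V y) i

  -- That the image contains k ℤⁿ with k ≠ 0 guarantees a nonzero first row, because a preimage of k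
  -- times the first basis vector has head k. The property passes to the complementary block: solve
  -- for the target 0 ∷ x and drop the first coordinate of the solution.
  diagonalise : ∀ {n} (B : Vec ℤ n → Vec ℤ n) → Linear B → ∀ k → k ≢ 0ℤ →
                (∀ x → ∃ λ y → B y ≡ k ⋆ x) → Diagonal B
  diagonalise {zero}  B B-lin k k≢0 k-onto =
    record { U = idᴬ ; V = idᴬ ; d = λ () ; diagonal = λ _ () }
  diagonalise {suc n} B B-lin k k≢0 k-onto = record
    { U = keepHead D.U ∘ᴬ P.U
    ; V = keepHead D.V ∘ᴬ (P.V ⁻¹ᴬ)
    ; d = d
    ; diagonal = λ y i → trans
        (cong (λ z → lookup (to (keepHead D.U) (to P.U (B z))) i) (sym (to-from P.V y)))
        (blocks (from P.V y) i)
    }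
    where
    open ≡-Reasoning
    P₀ : Pivot B
    P₀ = pivot B B-lin (proj₁ (k-onto (1ℤ ∷ 𝟘)) ,
      λ By≡0 → k≢0 (trans (sym (*-identityʳ k)) (trans (sym (cong head (proj₂ (k-onto (1ℤ ∷ 𝟘))))) By≡0)))
    module P = Pivot P₀

    k-onto-U : ∀ x → ∃ λ y → to P.U (B (to P.V y)) ≡ k ⋆ x
    k-onto-U x = from P.V y , (begin
      to P.U (B (to P.V (from P.V y))) ≡⟨ cong (to P.U ∘ B) (to-from P.V y) ⟩
      to P.U (B y)                     ≡⟨ cong (to P.U) By≡ ⟩
      to P.U (k ⋆ from P.U x)          ≡⟨ linear-⋆ {f = to P.U} (linear P.U) k (from P.U x) ⟩
      k ⋆ to P.U (from P.U x)          ≡⟨ cong (k ⋆_) (to-from P.U x) ⟩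
      k ⋆ x                            ∎)
      where
      y = proj₁ (k-onto (from P.U x))
      By≡ = proj₂ (k-onto (from P.U x))

    D₀ : Diagonal P.B′
    D₀ = diagonalise P.B′ P.B′-lin k k≢0 λ x → let y , By≡ = k-onto-U (0ℤ ∷ x) in
      tail y , cong tail (trans (sym (P.pivoted (head y) (tail y))) (trans (cong (to P.U ∘ B ∘ to P.V)
          (sym (head-tail y))) By≡))
    module D = Diagonal D₀

    d : Fin (suc n) → ℤ
    d Fin.zero    = P.d
    d (Fin.suc i) = D.d i

    blocks : ∀ y i → lookup (to (keepHead D.U) (to P.U (B (to P.V y)))) i
                   ≡ d i * lookup (to (keepHead D.V) y) i
    blocks (y₀ ∷ y) i = trans
      (cong (λ z → lookup (to (keepHead D.U) z) i) (P.pivoted y₀ y)) (entry i)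
      where
      entry : ∀ i → lookup (P.d * y₀ ∷ to D.U (P.B′ y)) i ≡ d i * lookup (y₀ ∷ to D.V y) i
      entry Fin.zero    = refl
      entry (Fin.suc i) = D.diagonal y i

  -- The 2 × 2 blocks

  -- One 2 × 2 block [[N , - b] , [- b′ , N]] of the diagonalised Laplacian, where b b′ = N; the
  -- common factor g of b and b′ is 1 or 2.
  record Block (N b b′ : ℤ) : Set where
    field
      doubled : Bool
    g : ℤ
    g = if doubled then + 2 else 1ℤ
    field
      h h′ u u′ : ℤ
      b≡gh    : b ≡ g * h
      b′≡gh′  : b′ ≡ g * h′
      bézout  : u * h + u′ * h′ ≡ 1ℤ
      bb′≡N   : b * b′ ≡ N

  -- If b and b′ are both even, half of the relation β b + β′ b′ = 2 is the Bézout identity of the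
  -- halves. If one of them is odd, say 2 t + 1, then 1 is this number minus t times 2, and
  -- replacing 2 by the relation gives the coefficients `u` and `u′`.
  mkBlock : ∀ N b b′ β β′ → b * b′ ≡ N → β * b + β′ * b′ ≡ + 2 → Block N b b′
  mkBlock N b b′ β β′ bb′≡N β-eq with parity b in pb | parity b′ in pb′
  ... | false | false with even⇒double b pb | even⇒double b′ pb′
  ... | h , refl | h′ , refl = record
    { doubled = true ; h = h ; h′ = h′ ; u = β ; u′ = β′ ; b≡gh = refl ; b′≡gh′ = refl
    ; bézout = *-cancelˡ-≡ (+ 2) _ _ (trans (factor β β′ h h′) β-eq) ; bb′≡N = bb′≡N }
    where
    factor : ∀ β β′ h h′ → + 2 * (β * h + β′ * h′) ≡ β * (+ 2 * h) + β′ * (+ 2 * h′)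
    factor = solve-∀
  mkBlock N b b′ β β′ bb′≡N β-eq | true | _ with odd⇒double+1 b pb
  ... | t , b≡ = record
    { doubled = false ; h = b ; h′ = b′ ; u = 1ℤ - t * β ; u′ = - (t * β′)
    ; b≡gh = sym (*-identityˡ b) ; b′≡gh′ = sym (*-identityˡ b′)
    ; bézout = begin
        (1ℤ - t * β) * b + - (t * β′) * b′   ≡⟨ regroup t β β′ b b′ ⟩
        b - t * (β * b + β′ * b′)            ≡⟨ cong₂ (λ x y → x - t * y) b≡ β-eq ⟩
        + 2 * t + 1ℤ - t * + 2               ≡⟨ cancel t ⟩
        1ℤ                                   ∎
    ; bb′≡N = bb′≡N }
    where
    open ≡-Reasoning
    regroup : ∀ t β β′ b b′ → (1ℤ - t * β) * b + - (t * β′) * b′ ≡ b - t * (β * b + β′ * b′)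
    regroup = solve-∀
    cancel : ∀ t → + 2 * t + 1ℤ - t * + 2 ≡ 1ℤ
    cancel = solve-∀
  mkBlock N b b′ β β′ bb′≡N β-eq | false | true with odd⇒double+1 b′ pb′
  ... | t , b′≡ = record
    { doubled = false ; h = b ; h′ = b′ ; u = - (t * β) ; u′ = 1ℤ - t * β′
    ; b≡gh = sym (*-identityˡ b) ; b′≡gh′ = sym (*-identityˡ b′)
    ; bézout = begin
        - (t * β) * b + (1ℤ - t * β′) * b′   ≡⟨ regroup t β β′ b b′ ⟩
        b′ - t * (β * b + β′ * b′)           ≡⟨ cong₂ (λ x y → x - t * y) b′≡ β-eq ⟩
        + 2 * t + 1ℤ - t * + 2               ≡⟨ cancel t ⟩
        1ℤ                                   ∎
    ; bb′≡N = bb′≡N }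
    where
    open ≡-Reasoning
    regroup : ∀ t β β′ b b′ → - (t * β) * b + (1ℤ - t * β′) * b′ ≡ b′ - t * (β * b + β′ * b′)
    regroup = solve-∀
    cancel : ∀ t → + 2 * t + 1ℤ - t * + 2 ≡ 1ℤ
    cancel = solve-∀

  -- Adding b′ times the first coordinate to the second turns the block into diag(g h , g k) up to
  -- unimodular column operations; h and k are coprime, so it has Smith form diag(g , g h k).
  module Smith {N b b′ : ℤ} (B : Block N b b′) where
    open Block B

    k λ′ μ exponent : ℤ
    k        = h′ * (N - 1ℤ)
    λ′       = u + u′ * (g * h′ * (g * h′))
    μ        = - u′
    exponent = g * (h * k)

    -- With Z = Y + b′ X these are X + Z and λ′ h Z - μ k X. The matrix taking (X , Z) to (S , T)
    -- has determinant λ′ h + μ k, which `coprime` shows to be 1.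
    S T : ℤ → ℤ → ℤ
    S X Y = X + (Y + b′ * X)
    T X Y = λ′ * h * (Y + b′ * X) - μ * k * X

    N≡ : N ≡ g * h * (g * h′)
    N≡ = trans (sym bb′≡N) (cong₂ _*_ b≡gh b′≡gh′)

    -- Modulo h the number N vanishes, so k is congruent to - h′ and μ = - u′ is the natural choice.
    -- Then μ k = u′ h′ - u′ h′ N, and the surplus u′ h′ N = u′ (g h′)² h is a multiple of h that
    -- the second term of `λ′` restores.
    coprime : λ′ * h + μ * k ≡ 1ℤ
    coprime = begin
      λ′ * h + μ * k                                        ≡⟨ regroup u u′ g h h′ N ⟩
      u * h + u′ * h′ + u′ * h′ * (g * h * (g * h′) - N)    ≡⟨ cong (λ z → u * h + u′ * h′ + u′ * h′ *
          (z - N)) N≡ ⟨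
      u * h + u′ * h′ + u′ * h′ * (N - N)                   ≡⟨ cancel (u * h + u′ * h′) (u′ * h′) N ⟩
      u * h + u′ * h′                                       ≡⟨ bézout ⟩
      1ℤ                                                    ∎
      where
      open ≡-Reasoning
      regroup : ∀ u u′ g h h′ N → (u + u′ * (g * h′ * (g * h′))) * h + (- u′) * (h′ * (N - 1ℤ))
                ≡ u * h + u′ * h′ + u′ * h′ * (g * h * (g * h′) - N)
      regroup = solve-∀
      cancel : ∀ a c N → a + c * (N - N) ≡ a
      cancel = solve-∀

    -- The substitution of P = b′ p - q for q is unimodular and makes the block diagonal: X = g h P,
    -- and in Y + b′ X the q-terms cancel because b b′ = N, which leaves g k p.
    image⇒divisible : ∀ p q {X Y} → X ≡ N * p - b * q → Y ≡ N * q - b′ * p →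
                      (∃ λ s → S X Y ≡ g * s) × (∃ λ t → T X Y ≡ exponent * t)
    image⇒divisible p q {X} {Y} X≡ Y≡ = (h * P + k * p , S≡) , (λ′ * p - μ * P , T≡)
      where
      open ≡-Reasoning
      P = g * h′ * p - q
      X-form : ∀ g h h′ p q → g * h * (g * h′) * p - g * h * q ≡ g * h * (g * h′ * p - q)
      X-form = solve-∀
      Y-form : ∀ b b′ N p q → (N * q - b′ * p) + b′ * (N * p - b * q) ≡ b′ * ((N - 1ℤ) * p) +
          (N - b * b′) * q
      Y-form = solve-∀
      XP : X ≡ g * h * P
      XP = begin
        X                                     ≡⟨ X≡ ⟩
        N * p - b * q                         ≡⟨ cong₂ (λ x y → x * p - y * q) N≡ b≡gh ⟩
        g * h * (g * h′) * p - g * h * q      ≡⟨ X-form g h h′ p q ⟩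
        g * h * P                             ∎
      reassoc : ∀ g h′ M p c q → g * h′ * (M * p) + (c - c) * q ≡ g * (h′ * M) * p
      reassoc = solve-∀
      Yk : Y + b′ * X ≡ g * k * p
      Yk = begin
        Y + b′ * X                                            ≡⟨ cong₂ (λ x y → y + b′ * x) X≡ Y≡ ⟩
        (N * q - b′ * p) + b′ * (N * p - b * q)               ≡⟨ Y-form b b′ N p q ⟩
        b′ * ((N - 1ℤ) * p) + (N - b * b′) * q
          ≡⟨ cong₂ (λ x y → x * ((N - 1ℤ) * p) + (N - y) * q) b′≡gh′ bb′≡N ⟩
        g * h′ * ((N - 1ℤ) * p) + (N - N) * q                 ≡⟨ reassoc g h′ (N - 1ℤ) p N q ⟩
        g * k * p                                             ∎
      S-form : ∀ g h k P p → g * h * P + g * k * p ≡ g * (h * P + k * p)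
      S-form = solve-∀
      T-form : ∀ g h k P p l m → l * h * (g * k * p) - m * k * (g * h * P) ≡ g * (h * k) * (l * p - m * P)
      T-form = solve-∀
      S≡ : S X Y ≡ g * (h * P + k * p)
      S≡ = trans (cong₂ _+_ XP Yk) (S-form g h k P p)
      T≡ : T X Y ≡ exponent * (λ′ * p - μ * P)
      T≡ = trans (cong₂ (λ x y → λ′ * h * y - μ * k * x) XP Yk) (T-form g h k P p λ′ μ)

    -- The inverse of the determinant-one change (S , T): X = λ′ h s - t and Y + b′ X = μ k s + t.
    X-of Y-of : ℤ → ℤ → ℤ
    X-of s t = λ′ * h * s - t
    Y-of s t = μ * k * s + t - b′ * X-of s t

    S-of : ∀ s t → S (X-of s t) (Y-of s t) ≡ s
    S-of s t = trans (regroup s t (λ′ * h) (μ * k) b′) (trans (cong (λ z → z * s) coprime)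
        (*-identityˡ s))
      where
      regroup : ∀ s t l m b′ → (l * s - t) + (m * s + t - b′ * (l * s - t) + b′ * (l * s - t)) ≡
          (l + m) * s
      regroup = solve-∀

    T-of : ∀ s t → T (X-of s t) (Y-of s t) ≡ t
    T-of s t = trans (regroup s t (λ′ * h) (μ * k) b′) (trans (cong (λ z → z * t) coprime)
        (*-identityˡ t))
      where
      regroup : ∀ s t l m b′ →
        l * (m * s + t - b′ * (l * s - t) + b′ * (l * s - t)) - m * (l * s - t) ≡ (l + m) * t
      regroup = solve-∀

    X-S-T : ∀ X Y → X ≡ X-of (S X Y) (T X Y)
    X-S-T X Y = sym (trans (regroup X (Y + b′ * X) (λ′ * h) (μ * k)) (trans (cong
        (λ z → z * X) coprime) (*-identityˡ X)))
      where
      regroup : ∀ X Z l m → l * (X + Z) - (l * Z - m * X) ≡ (l + m) * X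
      regroup = solve-∀

    Y-S-T : ∀ X Y → Y + b′ * X ≡ μ * k * S X Y + T X Y
    Y-S-T X Y = sym (trans (regroup X (Y + b′ * X) (λ′ * h) (μ * k)) (trans (cong (λ z → z *
        (Y + b′ * X)) coprime) (*-identityˡ (Y + b′ * X))))
      where
      regroup : ∀ X Z l m → m * (X + Z) + (l * Z - m * X) ≡ (l + m) * Z
      regroup = solve-∀

    divisible⇒image : ∀ X Y s t → S X Y ≡ g * s → T X Y ≡ exponent * t →
                      ∃₂ λ p q → X ≡ N * p - b * q × Y ≡ N * q - b′ * p
    divisible⇒image X Y s t S≡ T≡ = p , q , X≡ , Y≡
      where
      open ≡-Reasoning
      -- Solves s = h P + k p and t = λ′ p - μ P, the quotients found in `image⇒divisible`; the
      -- system has determinant 1 by `coprime`. The value of q is then recovered from P = g h′ p -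
      -- q.
      P = λ′ * s - k * t
      p = μ * s + h * t
      q = g * h′ * p - P
      X-form : ∀ g h k s t l → l * h * (g * s) - g * (h * k) * t ≡ g * h * (l * s - k * t)
      X-form = solve-∀
      X-back : ∀ g h h′ p P → g * h * P ≡ g * h * (g * h′) * p - g * h * (g * h′ * p - P)
      X-back = solve-∀
      XP : X ≡ g * h * P
      XP = trans (X-S-T X Y) (trans (cong₂ (λ x y → λ′ * h * x - y) S≡ T≡) (X-form g h k s t λ′))
      X≡ : X ≡ N * p - b * q
      X≡ = trans XP (trans (X-back g h h′ p P) (sym (cong₂ (λ x y → x * p - y * q) N≡ b≡gh)))
      Z-form : ∀ g h k s t m → m * k * (g * s) + g * (h * k) * t ≡ g * k * (m * s + h * t)
      Z-form = solve-∀
      Zp : Y + b′ * X ≡ g * k * p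
      Zp = trans (Y-S-T X Y) (trans (cong₂ (λ x y → μ * k * x + y) S≡ T≡) (Z-form g h k s t μ))
      isolate : ∀ Y c → Y ≡ Y + c - c
      isolate = solve-∀
      Y-back : ∀ g h h′ N p P → g * (h′ * (N - 1ℤ)) * p - g * h′ * (g * h * P)
               ≡ N * (g * h′ * p) - g * h * (g * h′) * P - g * h′ * p
      Y-back = solve-∀
      collect : ∀ N c p P d → N * c - N * P - d * p ≡ N * (c - P) - d * p
      collect = solve-∀
      Y≡ : Y ≡ N * q - b′ * p
      Y≡ = begin
        Y                                                       ≡⟨ isolate Y (b′ * X) ⟩
        Y + b′ * X - b′ * X                                     ≡⟨ cong₂ (λ x y → x - y) Zp
            (cong₂ _*_ b′≡gh′ XP) ⟩
        g * k * p - g * h′ * (g * h * P)                        ≡⟨ Y-back g h h′ N p P ⟩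
        N * (g * h′ * p) - g * h * (g * h′) * P - g * h′ * p    ≡⟨ cong₂ (λ x y → N *
            (g * h′ * p) - x * P - y * p) N≡ b′≡gh′ ⟨
        N * (g * h′ * p) - N * P - b′ * p                       ≡⟨ collect N (g * h′ * p) p P b′ ⟩
        N * q - b′ * p                                          ∎

    S-linear : ∀ a X Y X′ Y′ → S (a * X + X′) (a * Y + Y′) ≡ a * S X Y + S X′ Y′
    S-linear a X Y X′ Y′ = regroup a X Y X′ Y′ b′
      where
      regroup : ∀ a X Y X′ Y′ b → (a * X + X′) + (a * Y + Y′ + b * (a * X + X′)) ≡ a * (X +
          (Y + b * X)) + (X′ + (Y′ + b * X′))
      regroup = solve-∀

    T-linear : ∀ a X Y X′ Y′ → T (a * X + X′) (a * Y + Y′) ≡ a * T X Y + T X′ Y′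
    T-linear a X Y X′ Y′ = regroup a X Y X′ Y′ b′ (λ′ * h) (μ * k)
      where
      regroup : ∀ a X Y X′ Y′ b l m → l * (a * Y + Y′ + b * (a * X + X′)) - m * (a * X + X′)
        ≡ a * (l * (Y + b * X) - m * X) + (l * (Y′ + b * X′) - m * X′)
      regroup = solve-∀

    exponent-g : exponent * g ≡ N * N - N
    exponent-g = trans (regroup g h h′ (N - 1ℤ)) (trans (cong (λ z → z * (N - 1ℤ)) (sym N≡)) (expand N))
      where
      regroup : ∀ g h h′ M → g * (h * (h′ * M)) * g ≡ g * h * (g * h′) * M
      regroup = solve-∀
      expand : ∀ N → N * (N - 1ℤ) ≡ N * N - N
      expand = solve-∀

  -- Mod 2 the rows of the block are b b′ X + b Y and b b′ Y + b′ X. Both equal X + Y if b and b′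
  -- are odd, exactly one of them survives if one of b , b′ is odd, and both vanish if b and b′ are
  -- even. In every case b′ X + b Y spans the same space as the two rows.
  module RankForm {N b b′ : ℤ} (B : Block N b b′) where
    open Block B

    ρ : ℤ → ℤ → ℤ
    ρ X Y = b′ * X + b * Y

    private
      row : ∀ c X Y → parity (N * X - c * Y) ≡ ((parity b ∧ parity b′) ∧ parity X) xor
          (parity c ∧ parity Y)
      row c X Y = begin
        parity (N * X - c * Y)
          ≡⟨ cong (λ z → parity (N * X + z)) (neg c Y) ⟩
        parity (N * X + (- 1ℤ) * (c * Y))
          ≡⟨ parity-+ (N * X) ((- 1ℤ) * (c * Y)) ⟩
        parity (N * X) xor parity ((- 1ℤ) * (c * Y))
          ≡⟨ cong₂ _xor_ (trans (parity-* N X) (cong (_∧ parity X) (trans (cong parity (sym bb′≡N))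
              (parity-* b b′))))
                         (trans (parity-* (- 1ℤ) (c * Y)) (parity-* c Y)) ⟩
        ((parity b ∧ parity b′) ∧ parity X) xor (parity c ∧ parity Y) ∎
        where
        open ≡-Reasoning
        neg : ∀ c Y → - (c * Y) ≡ (- 1ℤ) * (c * Y)
        neg = solve-∀

      ρ-parity : ∀ X Y → parity (ρ X Y) ≡ (parity b′ ∧ parity X) xor (parity b ∧ parity Y)
      ρ-parity X Y = trans (parity-+ (b′ * X) (b * Y)) (cong₂ _xor_ (parity-* b′ X) (parity-* b Y))

    rows-even⇒ρ-even : ∀ X Y → parity (N * X - b * Y) ≡ false → parity (N * Y - b′ * X) ≡ false →
                       parity (ρ X Y) ≡ false
    rows-even⇒ρ-even X Y r₁ r₂ = trans (ρ-parity X Y)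
      (go (parity b) (parity b′) (parity X) (parity Y) (trans (sym (row b X Y)) r₁) (trans (sym
          (row b′ Y X)) r₂))
      where
      go : ∀ b b′ x y → ((b ∧ b′) ∧ x) xor (b ∧ y) ≡ false → ((b ∧ b′) ∧ y) xor (b′ ∧ x) ≡ false →
           (b′ ∧ x) xor (b ∧ y) ≡ false
      go true  true  x    y     r₁ _  = r₁
      go true  false x    y     r₁ _  = r₁
      go false true  true  y    _  r₂ = r₂
      go false true  false y    _  r₂ = r₂
      go false false x    y     _  _  = refl

    ρ-even⇒row₁-even : ∀ X Y → parity (ρ X Y) ≡ false → parity (N * X - b * Y) ≡ false
    ρ-even⇒row₁-even X Y r = trans (row b X Y)
      (go (parity b) (parity b′) (parity X) (parity Y) (trans (sym (ρ-parity X Y)) r))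
      where
      go : ∀ b b′ x y → (b′ ∧ x) xor (b ∧ y) ≡ false → ((b ∧ b′) ∧ x) xor (b ∧ y) ≡ false
      go true  b′ x y r = r
      go false b′ x y _ = refl

    ρ-even⇒row₂-even : ∀ X Y → parity (ρ X Y) ≡ false → parity (N * Y - b′ * X) ≡ false
    ρ-even⇒row₂-even X Y r = trans (row b′ Y X)
      (go (parity b) (parity b′) (parity X) (parity Y) (trans (sym (ρ-parity X Y)) r))
      where
      go : ∀ b b′ x y → (b′ ∧ x) xor (b ∧ y) ≡ false → ((b ∧ b′) ∧ y) xor (b′ ∧ x) ≡ false
      go true  true  true  true  r = r
      go true  true  false false r = r
      go true  false x     true  ()
      go true  false x     false r = refl
      go false true  true  y     ()
      go false true  false y     r = refl
      go false false x     y     r = refl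

    doubled⇒ρ-even : ∀ X Y → doubled ≡ true → parity (ρ X Y) ≡ false
    doubled⇒ρ-even X Y refl = trans (ρ-parity X Y)
      (cong₂ (λ c d → (c ∧ parity X) xor (d ∧ parity Y))
        (trans (cong parity b′≡gh′) (parity-double h′)) (trans (cong parity b≡gh) (parity-double h)))

    -- For g = 1 the Bézout identity reads u b + u′ b′ = 1, so the form attains every integer c.
    ρ-section : ∀ c → doubled ≡ false → ρ (c * u′) (c * u) ≡ c
    ρ-section c refl = begin
      b′ * (c * u′) + b * (c * u)              ≡⟨ cong₂ (λ x y → x * (c * u′) + y * (c * u)) b′≡gh′ b≡gh ⟩
      1ℤ * h′ * (c * u′) + 1ℤ * h * (c * u)    ≡⟨ regroup h h′ u u′ c ⟩
      c * (u * h + u′ * h′)                    ≡⟨ cong (λ z → c * z) bézout ⟩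
      c * 1ℤ                                   ≡⟨ *-identityʳ c ⟩
      c                                        ∎
      where
      open ≡-Reasoning
      regroup : ∀ h h′ u u′ c → 1ℤ * h′ * (c * u′) + 1ℤ * h * (c * u) ≡ c * (u * h + u′ * h′)
      regroup = solve-∀

    ρ-linear : ∀ a X Y X′ Y′ → ρ (a * X + X′) (a * Y + Y′) ≡ a * ρ X Y + ρ X′ Y′
    ρ-linear a X Y X′ Y′ = regroup a X Y X′ Y′ b b′
      where
      regroup : ∀ a X Y X′ Y′ b b′ → b′ * (a * X + X′) + b * (a * Y + Y′) ≡ a * (b′ * X + b * Y) +
          (b′ * X′ + b * Y′)
      regroup = solve-∀

  -- ρ is the one linear form through which the block acts mod 2.
  record SmithBlock (N b b′ : ℤ) : Set where
    field
      doubled : Bool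
    g : ℤ
    g = if doubled then + 2 else 1ℤ
    field
      exponent         : ℤ
      exponent-g       : exponent * g ≡ N * N - N
      S T              : ℤ → ℤ → ℤ
      S-linear         : ∀ a X Y X′ Y′ → S (a * X + X′) (a * Y + Y′) ≡ a * S X Y + S X′ Y′
      T-linear         : ∀ a X Y X′ Y′ → T (a * X + X′) (a * Y + Y′) ≡ a * T X Y + T X′ Y′
      X-of Y-of        : ℤ → ℤ → ℤ
      S-of             : ∀ s t → S (X-of s t) (Y-of s t) ≡ s
      T-of             : ∀ s t → T (X-of s t) (Y-of s t) ≡ t
      image⇒divisible  : ∀ p q {X Y} → X ≡ N * p - b * q → Y ≡ N * q - b′ * p →
                         (∃ λ s → S X Y ≡ g * s) × (∃ λ t → T X Y ≡ exponent * t)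
      divisible⇒image  : ∀ X Y s t → S X Y ≡ g * s → T X Y ≡ exponent * t →
                         ∃₂ λ p q → X ≡ N * p - b * q × Y ≡ N * q - b′ * p
      ρ                : ℤ → ℤ → ℤ
      ρ-linear         : ∀ a X Y X′ Y′ → ρ (a * X + X′) (a * Y + Y′) ≡ a * ρ X Y + ρ X′ Y′
      rows-even⇒ρ-even : ∀ X Y → parity (N * X - b * Y) ≡ false → parity (N * Y - b′ * X) ≡ false →
                         parity (ρ X Y) ≡ false
      ρ-even⇒row₁-even : ∀ X Y → parity (ρ X Y) ≡ false → parity (N * X - b * Y) ≡ false
      ρ-even⇒row₂-even : ∀ X Y → parity (ρ X Y) ≡ false → parity (N * Y - b′ * X) ≡ false
      doubled⇒ρ-even   : ∀ X Y → doubled ≡ true → parity (ρ X Y) ≡ false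
      u u′             : ℤ
      ρ-section        : ∀ c → doubled ≡ false → ρ (c * u′) (c * u) ≡ c

  smithBlock : ∀ {N b b′} → Block N b b′ → SmithBlock N b b′
  smithBlock B = record
    { doubled = Block.doubled B ; u = Block.u B ; u′ = Block.u′ B ; Smith B ; RankForm B }

  -- The cokernel of a block-diagonal matrix

  -- The two fibres of a Boolean function, each numbered from zero, with `class` inverse to the
  -- embeddings. It separates the halves of the graph as well as the blocks with g = 2 from those
  -- with g = 1.
  record Split {v : ℕ} (p : Fin v → Bool) : Set where
    field
      n m         : ℕ
      embed-false : Fin n → Fin v
      embed-true  : Fin m → Fin v
      class       : Fin v → Fin n ⊎ Fin m
      p-false     : ∀ i → p (embed-false i) ≡ false
      p-true      : ∀ j → p (embed-true j) ≡ true
      class-false : ∀ i → class (embed-false i) ≡ inj₁ i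
      class-true  : ∀ j → class (embed-true j) ≡ inj₂ j
      embed-class : ∀ x → [ embed-false , embed-true ]′ (class x) ≡ x
      size        : n ℕ.+ m ≡ v

    find-false : ∀ x → p x ≡ false → ∃ λ i → embed-false i ≡ x
    find-false x px with class x | embed-class x
    ... | inj₁ i | i≡x = i , i≡x
    ... | inj₂ j | j≡x = contradiction (trans (sym (p-true j)) (trans (cong p j≡x) px)) λ ()

    find-true : ∀ x → p x ≡ true → ∃ λ j → embed-true j ≡ x
    find-true x px with class x | embed-class x
    ... | inj₁ i | i≡x = contradiction (trans (sym (p-false i)) (trans (cong p i≡x) px)) λ ()
    ... | inj₂ j | j≡x = j , j≡x

  split : ∀ {v} (p : Fin v → Bool) → Split p
  split {zero} p = record
    { n = 0 ; m = 0 ; embed-false = λ () ; embed-true = λ () ; class = λ () ; p-false = λ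
        () ; p-true = λ ()
    ; class-false = λ () ; class-true = λ () ; embed-class = λ () ; size = refl }
  split {suc v} p with p Fin.zero in p0 | split (λ x → p (Fin.suc x))
  ... | false | R = record
    { n = suc R.n ; m = R.m
    ; embed-false = Fin.lift 1 R.embed-false
    ; embed-true  = λ j → Fin.suc (R.embed-true j)
    ; class = λ { Fin.zero → inj₁ Fin.zero ; (Fin.suc x) → Sum.map₁ Fin.suc (R.class x) }
    ; p-false = λ { Fin.zero → p0 ; (Fin.suc i) → R.p-false i }
    ; p-true  = R.p-true
    ; class-false = λ { Fin.zero → refl ; (Fin.suc i) → cong (Sum.map₁ Fin.suc) (R.class-false i) }
    ; class-true  = λ j → cong (Sum.map₁ Fin.suc) (R.class-true j)
    ; embed-class = λ { Fin.zero → refl ; (Fin.suc x) → embed-class x }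
    ; size = cong suc R.size }
    where
    module R = Split R
    embed-class : ∀ x → [ (Fin.lift 1 R.embed-false)
                        , (λ j → Fin.suc (R.embed-true j)) ]′ (Sum.map₁ Fin.suc (R.class x)) ≡ Fin.suc x
    embed-class x with R.class x | R.embed-class x
    ... | inj₁ i | i≡x = cong Fin.suc i≡x
    ... | inj₂ j | j≡x = cong Fin.suc j≡x
  ... | true | R = record
    { n = R.n ; m = suc R.m
    ; embed-true = Fin.lift 1 R.embed-true
    ; embed-false  = λ j → Fin.suc (R.embed-false j)
    ; class = λ { Fin.zero → inj₂ Fin.zero ; (Fin.suc x) → Sum.map₂ Fin.suc (R.class x) }
    ; p-true = λ { Fin.zero → p0 ; (Fin.suc i) → R.p-true i }
    ; p-false  = R.p-false
    ; class-true = λ { Fin.zero → refl ; (Fin.suc i) → cong (Sum.map₂ Fin.suc) (R.class-true i) }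
    ; class-false  = λ j → cong (Sum.map₂ Fin.suc) (R.class-false j)
    ; embed-class = λ { Fin.zero → refl ; (Fin.suc x) → embed-class x }
    ; size = trans (ℕ.+-suc R.n R.m) (cong suc R.size) }
    where
    module R = Split R
    embed-class : ∀ x → [ (λ j → Fin.suc (R.embed-false j))
                        , (Fin.lift 1 R.embed-true) ]′
                        (Sum.map₂ Fin.suc (R.class x)) ≡ Fin.suc x
    embed-class x with R.class x | R.embed-class x
    ... | inj₁ i | i≡x = cong Fin.suc i≡x
    ... | inj₂ j | j≡x = cong Fin.suc j≡x

  -- Integral coordinates (X , Y) on functions on the vertices: `point` and `injective` make them
  -- bijective, and L acts on the i-th pair by [[N , - b i] , [- b′ i , N]]. Functions have no
  -- useful propositional equality, so all conditions are pointwise.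
  record BlockDiagonal {v : ℕ} (N : ℕ) (L : Fin v → Fin v → ℤ) : Set where
    field
      n       : ℕ
      v≡n+n   : v ≡ n ℕ.+ n
      b b′    : Fin n → ℤ
      block   : ∀ i → SmithBlock (+ N) (b i) (b′ i)
      X Y     : (Fin v → ℤ) → Fin n → ℤ
      X-linear : ∀ a {f g k : Fin v → ℤ} → (∀ x → k x ≡ a * f x + g x) → ∀ i → X k i ≡ a * X f i + X g i
      Y-linear : ∀ a {f g k : Fin v → ℤ} → (∀ x → k x ≡ a * f x + g x) → ∀ i → Y k i ≡ a * Y f i + Y g i
      point   : (Fin n → ℤ) → (Fin n → ℤ) → Fin v → ℤ
      X-point : ∀ p q i → X (point p q) i ≡ p i
      Y-point : ∀ p q i → Y (point p q) i ≡ q i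
      injective : ∀ f g → (∀ i → X f i ≡ X g i) → (∀ i → Y f i ≡ Y g i) → ∀ x → f x ≡ g x
      X-L     : ∀ f i → X (matVec L f) i ≡ + N * X f i - b i * Y f i
      Y-L     : ∀ f i → Y (matVec L f) i ≡ + N * Y f i - b′ i * X f i

  square∸ : ∀ N → + (N ℕ.* N ℕ.∸ N) ≡ + N * + N - + N
  square∸ zero    = refl
  square∸ (suc N) = begin
    + (suc N ℕ.* suc N ℕ.∸ suc N)         ≡⟨ cong +_ (ℕ.m+n∸m≡n (suc N) (N ℕ.* suc N)) ⟩
    + (N ℕ.* suc N)                       ≡⟨ cancel (+ suc N) (+ (N ℕ.* suc N)) ⟩
    + suc N + + (N ℕ.* suc N) - + suc N   ≡⟨ cong (λ z → z - + suc N) (pos-* (suc N) (suc N)) ⟩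
    + suc N * + suc N - + suc N           ∎
    where
    open ≡-Reasoning
    cancel : ∀ x y → y ≡ x + y - x
    cancel = solve-∀

  -- Only the absolute value of the modulus matters, which spares determining the sign of
  -- `exponent`.
  CongMod⁺ : ∀ k M s t z → ∣ M ∣ ≡ k → s - t ≡ M * z → CongMod k s t
  CongMod⁺ k M s t z refl eq =
    ∣⇒∣ᵤ {+ ∣ M ∣} {s - t} (∣-trans {+ ∣ M ∣} {M} {s - t} ∣m∣∣m (divides z (trans eq (*-comm M z))))

  CongMod⁻ : ∀ k M s t → ∣ M ∣ ≡ k → CongMod k s t → ∃ λ z → s - t ≡ M * z
  CongMod⁻ k M s t refl k∣ with ∣ᵤ⇒∣ {M} {s - t} k∣
  ... | divides z eq = z , trans eq (*-comm z M)

  module Cokernel {v N : ℕ} {L : Fin v → Fin v → ℤ} (2≤N : 2 ℕ.≤ N) (D : BlockDiagonal N L) where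
    open BlockDiagonal D
    module Sm i = SmithBlock (block i)
    open Split (split Sm.doubled) public using ()
      renaming (n to k; m to m; embed-false to simple; embed-true to double; class to class;
                p-false to is-simple; p-true to is-double; class-false to class-simple;
                class-true to class-double; embed-class to embed-class; size to k+m≡n)

    q p : ℕ
    q = N ℕ.* N ℕ.∸ N
    p = q ℕ./ 2

    exponent-simple : ∀ i → Sm.doubled i ≡ false → ∣ Sm.exponent i ∣ ≡ q
    exponent-simple i simple-i = begin
      ∣ Sm.exponent i ∣           ≡⟨ cong ∣_∣ (*-identityʳ (Sm.exponent i)) ⟨
      ∣ Sm.exponent i * 1ℤ ∣      ≡⟨ cong (λ b → ∣ Sm.exponent i * (if b then + 2 else 1ℤ) ∣) simple-i ⟨
      ∣ Sm.exponent i * Sm.g i ∣   ≡⟨ cong ∣_∣ (trans (Sm.exponent-g i) (sym (square∸ N))) ⟩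
      q                           ∎
      where open ≡-Reasoning

    exponent-double : ∀ i → Sm.doubled i ≡ true → ∣ Sm.exponent i ∣ ≡ p
    exponent-double i double-i = begin
      ∣ Sm.exponent i ∣                    ≡⟨ ℕ.m*n/n≡m ∣ Sm.exponent i ∣ 2 ⟨
      ∣ Sm.exponent i ∣ ℕ.* 2 ℕ./ 2        ≡⟨ cong (ℕ._/ 2) (abs-* (Sm.exponent i) (+ 2)) ⟨
      ∣ Sm.exponent i * + 2 ∣ ℕ./ 2        ≡⟨ cong (λ b → ∣ Sm.exponent i *
          (if b then + 2 else 1ℤ) ∣ ℕ./ 2) double-i ⟨
      ∣ Sm.exponent i * Sm.g i ∣ ℕ./ 2      ≡⟨ cong (λ z → ∣ z ∣ ℕ./ 2) (trans (Sm.exponent-g i) (sym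
          (square∸ N))) ⟩
      q ℕ./ 2                              ∎
      where open ≡-Reasoning

    g-double : ∀ i → Sm.doubled i ≡ true → ∣ Sm.g i ∣ ≡ 2
    g-double i double-i = cong (λ b → ∣ (if b then + 2 else 1ℤ) ∣) double-i

    g-simple : ∀ i → Sm.doubled i ≡ false → Sm.g i ≡ 1ℤ
    g-simple i simple-i = cong (λ b → if b then + 2 else 1ℤ) simple-i

    S T : (Fin v → ℤ) → Fin n → ℤ
    S f i = Sm.S i (X f i) (Y f i)
    T f i = Sm.T i (X f i) (Y f i)

    S-linear : ∀ a {f g h : Fin v → ℤ} → (∀ x → h x ≡ a * f x + g x) → ∀ i → S h i ≡ a * S f i + S g i
    S-linear a {f} {g} h≡ i = trans (cong₂ (Sm.S i) (X-linear a h≡ i) (Y-linear a h≡ i))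
                            (Sm.S-linear i a (X f i) (Y f i) (X g i) (Y g i))

    T-linear : ∀ a {f g h : Fin v → ℤ} → (∀ x → h x ≡ a * f x + g x) → ∀ i → T h i ≡ a * T f i + T g i
    T-linear a {f} {g} h≡ i = trans (cong₂ (Sm.T i) (X-linear a h≡ i) (Y-linear a h≡ i))
                            (Sm.T-linear i a (X f i) (Y f i) (X g i) (Y g i))

    private
      minus : ∀ x y → x - y ≡ (- 1ℤ) * y + x
      minus = solve-∀

    S-minus : ∀ f g i → S (λ x → f x - g x) i ≡ S f i - S g i
    S-minus f g i = trans (S-linear (- 1ℤ) {g} {f} (λ x → minus (f x) (g x)) i) (sym (minus (S f i)
        (S g i)))

    T-minus : ∀ f g i → T (λ x → f x - g x) i ≡ T f i - T g i
    T-minus f g i = trans (T-linear (- 1ℤ) {g} {f} (λ x → minus (f x) (g x)) i) (sym (minus (T f i)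
        (T g i)))

    -- Being zero in the direct sum of the groups ℤ/g ⊕ ℤ/exponent over all blocks.
    Vanishes : (Fin n → ℤ) → (Fin n → ℤ) → Set
    Vanishes s t = ∀ i → (∃ λ z → s i ≡ Sm.g i * z) × (∃ λ z → t i ≡ Sm.exponent i * z)

    coker⇒ : ∀ f g → CokerEq L f g → Vanishes (λ i → S f i - S g i) (λ i → T f i - T g i)
    coker⇒ f g (z , f-g≡Lz) i
      with Sm.image⇒divisible i (X z i) (Y z i)
             (trans (agree X X-linear i) (X-L z i)) (trans (agree Y Y-linear i) (Y-L z i))
      where
      agree : (W : (Fin v → ℤ) → Fin n → ℤ) →
              (∀ a {f g k : Fin v → ℤ} → (∀ x → k x ≡ a * f x + g x) → ∀ i → W k i ≡ a * W f i + W g i) →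
              ∀ i → W (λ x → f x - g x) i ≡ W (matVec L z) i
      -- The coefficient 0 turns the linearity condition into invariance under pointwise equality.
      agree W W-linear i = trans (W-linear 0ℤ {matVec L z} {matVec L z} (λ x → trans (f-g≡Lz x) (sym
          (+-identityˡ (matVec L z x)))) i)
                                 (+-identityˡ (W (matVec L z) i))
    ... | (s , s≡) , (t , t≡) = (s , trans (sym (S-minus f g i)) s≡) , (t , trans (sym
        (T-minus f g i)) t≡)

    coker⇐ : ∀ f g → Vanishes (λ i → S f i - S g i) (λ i → T f i - T g i) → CokerEq L f g
    coker⇐ f g van = z , injective (λ x → f x - g x) (matVec L z)
      (λ i → trans (proj₁ (proj₂ (proj₂ (solved i)))) (sym (trans (X-L z i) (cong₂
          (λ x y → + N * x - b i * y) (X-point _ _ i) (Y-point _ _ i)))))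
      (λ i → trans (proj₂ (proj₂ (proj₂ (solved i)))) (sym (trans (Y-L z i) (cong₂
          (λ x y → + N * y - b′ i * x) (X-point _ _ i) (Y-point _ _ i)))))
      where
      d : Fin v → ℤ
      d x = f x - g x
      solved : ∀ i → ∃₂ λ p q → X d i ≡ + N * p - b i * q × Y d i ≡ + N * q - b′ i * p
      solved i with van i
      ... | (s , s≡) , (t , t≡) =
        Sm.divisible⇒image i (X d i) (Y d i) s t (trans (S-minus f g i) s≡) (trans (T-minus f g i) t≡)
      z : Fin v → ℤ
      z = point (λ i → proj₁ (solved i)) (λ i → proj₁ (proj₂ (solved i)))

    represent : (Fin n → ℤ) → (Fin n → ℤ) → Fin v → ℤ
    represent s t = point (λ i → Sm.X-of i (s i) (t i)) (λ i → Sm.Y-of i (s i) (t i))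

    S-represent : ∀ s t i → S (represent s t) i ≡ s i
    S-represent s t i = trans (cong₂ (Sm.S i) (X-point _ _ i) (Y-point _ _ i)) (Sm.S-of i (s i) (t i))

    T-represent : ∀ s t i → T (represent s t) i ≡ t i
    T-represent s t i = trans (cong₂ (Sm.T i) (X-point _ _ i) (Y-point _ _ i)) (Sm.T-of i (s i) (t i))

    -- A block with g = 2 receives one coordinate mod 2 and one mod p. In a block with g = 1 the
    -- coordinate `S` lives in the trivial group ℤ/1 and is filled with 0, so only a coordinate mod
    -- q remains.
    S-target T-target : Target m k → Fin n → ℤ
    S-target (s₁ , s₂ , s₃) i = [ (λ _ → 0ℤ) , s₁ ]′ (class i)
    T-target (s₁ , s₂ , s₃) i = [ s₃ , s₂ ]′ (class i)

    to-coker : Target m k → Fin v → ℤ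
    to-coker s = represent (S-target s) (T-target s)

    Vanishesᵀ : Target m k → Target m k → Set
    Vanishesᵀ s t = Vanishes (λ i → S-target s i - S-target t i) (λ i → T-target s i - T-target t i)

    target⇒ : ∀ s t → TargetEq p q s t → Vanishesᵀ s t
    target⇒ (s₁ , s₂ , s₃) (t₁ , t₂ , t₃) (e₁ , e₂ , e₃) i with class i | embed-class i
    ... | inj₁ j | refl = (0ℤ , sym (*-zeroʳ (Sm.g i))) , CongMod⁻ q (Sm.exponent i) (s₃ j) (t₃ j)
        (exponent-simple i (is-simple j)) (e₃ j)
    ... | inj₂ j | refl = CongMod⁻ 2 (Sm.g i) (s₁ j) (t₁ j) (g-double i (is-double j))
        (e₁ j) , CongMod⁻ p (Sm.exponent i) (s₂ j) (t₂ j) (exponent-double i (is-double j)) (e₂ j)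

    target⇐ : ∀ s t → Vanishesᵀ s t → TargetEq p q s t
    target⇐ (s₁ , s₂ , s₃) (t₁ , t₂ , t₃) van = e₁ , e₂ , e₃
      where
      e₁ : ∀ j → CongMod 2 (s₁ j) (t₁ j)
      e₁ j with class (double j) | class-double j | proj₁ (van (double j))
      ... | _ | refl | z , z≡ = CongMod⁺ 2 (Sm.g (double j)) (s₁ j) (t₁ j) z (g-double (double j)
          (is-double j)) z≡
      e₂ : ∀ j → CongMod p (s₂ j) (t₂ j)
      e₂ j with class (double j) | class-double j | proj₂ (van (double j))
      ... | _ | refl | z , z≡ = CongMod⁺ p (Sm.exponent (double j)) (s₂ j) (t₂ j) z (exponent-double
          (double j) (is-double j)) z≡
      e₃ : ∀ j → CongMod q (s₃ j) (t₃ j)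
      e₃ j with class (simple j) | class-simple j | proj₂ (van (simple j))
      ... | _ | refl | z , z≡ = CongMod⁺ q (Sm.exponent (simple j)) (s₃ j) (t₃ j) z (exponent-simple
          (simple j) (is-simple j)) z≡

    Vanishes-resp : ∀ {s s′ t t′} → (∀ i → s i ≡ s′ i) →
        (∀ i → t i ≡ t′ i) → Vanishes s t → Vanishes s′ t′
    Vanishes-resp s≗ t≗ van i with van i
    ... | (y , y≡) , (z , z≡) = (y , trans (sym (s≗ i)) y≡) , (z , trans (sym (t≗ i)) z≡)

    Vanishes-0 : ∀ {s t} → (∀ i → s i ≡ 0ℤ) → (∀ i → t i ≡ 0ℤ) → Vanishes s t
    Vanishes-0 s≡0 t≡0 i = (0ℤ , trans (s≡0 i) (sym (*-zeroʳ (Sm.g i)))) , (0ℤ , trans (t≡0 i) (sym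
        (*-zeroʳ (Sm.exponent i))))

    cokernel-iso : TorsionCokerIso L m k p q
    cokernel-iso = record
      { g         = to-coker
      ; well-def  = λ s t e → coker⇐ (to-coker s) (to-coker t)
          (Vanishes-resp (λ i → sym (S-diff s t i)) (λ i → sym (T-diff s t i)) (target⇒ s t e))
      ; additive  = λ s t → coker⇐ (to-coker (s +T t)) (to-coker s +ᵥ to-coker t)
          (Vanishes-0 (λ i → cancelled (trans (S-represent _ _ i) (S-+T s t i))
                               (trans (S-linear 1ℤ {to-coker s} {to-coker t} (λ x → unit
                                   (to-coker s x) (to-coker t x)) i)
                                 (cong₂ (λ x y → 1ℤ * x + y) (S-represent _ _ i) (S-represent _ _ i)))
                               )
                      (λ i → cancelled (trans (T-represent _ _ i) (T-+T s t i))
                               (trans (T-linear 1ℤ {to-coker s} {to-coker t} (λ x → unit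
                                   (to-coker s x) (to-coker t x)) i)
                                 (cong₂ (λ x y → 1ℤ * x + y) (T-represent _ _ i) (T-represent _ _ i)))
                               ))
      ; injective = λ s t e → target⇐ s t
          (Vanishes-resp (S-diff s t) (T-diff s t) (coker⇒ (to-coker s) (to-coker t) e))
      ; into-tors = λ s → torsion (to-coker s)
      ; onto-tors = λ x _ → from-coker x , coker⇐ (to-coker (from-coker x)) x (onto x)
      }
      where
      S-diff : ∀ s t i → S (to-coker s) i - S (to-coker t) i ≡ S-target s i - S-target t i
      S-diff s t i = cong₂ (λ x y → x - y) (S-represent _ _ i) (S-represent _ _ i)
      T-diff : ∀ s t i → T (to-coker s) i - T (to-coker t) i ≡ T-target s i - T-target t i
      T-diff s t i = cong₂ (λ x y → x - y) (T-represent _ _ i) (T-represent _ _ i)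

      unit : ∀ x y → x + y ≡ 1ℤ * x + y
      unit x y = cong (λ z → z + y) (sym (*-identityˡ x))

      cancelled : ∀ {x y z} → x ≡ z → y ≡ z → x - y ≡ 0ℤ
      cancelled {z = z} refl refl = +-inverseʳ z

      S-+T : ∀ s t i → S-target (s +T t) i ≡ 1ℤ * S-target s i + S-target t i
      S-+T (s₁ , _ , _) (t₁ , _ , _) i with class i
      ... | inj₁ j = refl
      ... | inj₂ j = unit (s₁ j) (t₁ j)

      T-+T : ∀ s t i → T-target (s +T t) i ≡ 1ℤ * T-target s i + T-target t i
      T-+T (_ , s₂ , s₃) (_ , t₂ , t₃) i with class i
      ... | inj₁ j = unit (s₃ j) (t₃ j)
      ... | inj₂ j = unit (s₂ j) (t₂ j)

      from-coker : (Fin v → ℤ) → Target m k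
      from-coker f = (λ j → S f (double j)) , (λ j → T f (double j)) , (λ j → T f (simple j))

      onto : ∀ f → Vanishes (λ i → S (to-coker (from-coker f)) i - S f i) (λ i → T (to-coker
          (from-coker f)) i - T f i)
      onto f = Vanishes-resp (λ i → cong (λ z → z - S f i) (sym (S-represent _ _ i)))
                             (λ i → cong (λ z → z - T f i) (sym (T-represent _ _ i))) direct
        where
        direct : Vanishes (λ i → S-target (from-coker f) i - S f i) (λ i → T-target
            (from-coker f) i - T f i)
        direct i with class i | embed-class i
        -- The coordinate `S f i` was discarded in this block, which is harmless: with g = 1 the
        -- difference is its own quotient.
        ... | inj₁ j | refl = (0ℤ - S f i , trans (sym (*-identityˡ (0ℤ - S f i)))
                                 (cong (λ z → z * (0ℤ - S f i)) (sym (g-simple i (is-simple j)))))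
                            , (0ℤ , trans (+-inverseʳ (T f i)) (sym (*-zeroʳ (Sm.exponent i))))
        ... | inj₂ j | refl = (0ℤ , trans (+-inverseʳ (S f i)) (sym (*-zeroʳ (Sm.g i))))
                            , (0ℤ , trans (+-inverseʳ (T f i)) (sym (*-zeroʳ (Sm.exponent i))))

      q≢0 : ∀ N → 2 ℕ.≤ N → ℕ.NonZero (N ℕ.* N ℕ.∸ N)
      q≢0 (suc zero) (ℕ.s≤s ())
      q≢0 (suc (suc N)) _ = ℕ.>-nonZero (ℕ.m<n⇒0<n∸m (ℕ.m<m*n (suc (suc N)) (suc (suc N)) (ℕ.s≤s
          (ℕ.s≤s ℕ.z≤n))))

      -- In every block q = exponent · g is a multiple of both moduli, so q annihilates the whole
      -- cokernel; it is nonzero because N ≥ 2.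
      torsion : ∀ f → IsTorsion L f
      torsion f = q , q≢0 N 2≤N , coker⇐ ((+ q) ·ᵥ f) (λ _ → 0ℤ) divisible
        where
        homogeneous : ∀ {W : (Fin v → ℤ) → Fin n → ℤ} →
          (∀ a {f g k : Fin v → ℤ} → (∀ x → k x ≡ a * f x + g x) → ∀ i → W k i ≡ a * W f i + W g i) →
          ∀ i → W ((+ q) ·ᵥ f) i - W (λ _ → 0ℤ) i ≡ + q * W f i
        homogeneous {W} W-linear i = trans
          (cong (λ z → z - W (λ _ → 0ℤ) i) (W-linear (+ q) {f} {λ _ → 0ℤ} (λ x → sym (+-identityʳ
              (+ q * f x))) i))
          (drop (+ q * W f i) (W (λ _ → 0ℤ) i))
          where
          drop : ∀ x y → x + y - y ≡ x
          drop = solve-∀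
        q≡ : ∀ i → + q ≡ Sm.exponent i * Sm.g i
        q≡ i = trans (square∸ N) (sym (Sm.exponent-g i))
        reassoc₁ : ∀ e g w → e * g * w ≡ g * (e * w)
        reassoc₁ = solve-∀
        divisible : Vanishes (λ i → S ((+ q) ·ᵥ f) i - S (λ _ → 0ℤ) i) (λ i → T ((+ q) ·ᵥ f) i - T
            (λ _ → 0ℤ) i)
        divisible i =
          (Sm.exponent i * S f i , trans (homogeneous S-linear i) (trans (cong (λ z → z * S f i)
              (q≡ i)) (reassoc₁ (Sm.exponent i) (Sm.g i) (S f i)))) ,
          (Sm.g i * T f i , trans (homogeneous T-linear i) (trans (cong (λ z → z * T f i) (q≡ i))
              (*-assoc (Sm.exponent i) (Sm.g i) (T f i))))

  -- Rank over 𝔽₂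

  parity-sum-even : ∀ {k} (f : Fin k → ℤ) → (∀ i → parity (f i) ≡ false) → parity (sumℤ f) ≡ false
  parity-sum-even {zero}  f even = refl
  parity-sum-even {suc k} f even = trans (parity-+ (f Fin.zero) (sumℤ (λ i → f (Fin.suc i))))
    (cong₂ _xor_ (even Fin.zero) (parity-sum-even (λ i → f (Fin.suc i)) (λ i → even (Fin.suc i))))

  private
    bit : Fin 2 → Bool
    bit Fin.zero    = false
    bit (Fin.suc _) = true

    unbit : Bool → Fin 2
    unbit false = Fin.zero
    unbit true  = Fin.suc Fin.zero

    unbit-injective : ∀ {a b} → unbit a ≡ unbit b → a ≡ b
    unbit-injective {true}  {true}  _ = refl
    unbit-injective {false} {false} _ = refl

    bit-injective : ∀ {a b} → bit a ≡ bit b → a ≡ b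
    bit-injective {Fin.zero}        {Fin.zero}        _ = refl
    bit-injective {Fin.suc Fin.zero} {Fin.suc Fin.zero} _ = refl

    funToFin-cong : ∀ {m n} {f g : Fin m → Fin n} → (∀ i → f i ≡ g i) → funToFin f ≡ funToFin g
    funToFin-cong {zero}  f≗g = refl
    funToFin-cong {suc m} f≗g = cong₂ combine (f≗g Fin.zero) (funToFin-cong (λ i → f≗g (Fin.suc i)))

  -- Of the 2^l combinations with coefficients 0 and 1, two must agree mod 2 in all k columns.
  leftKernel : ∀ {k l} → k ℕ.< l → (A : Fin l → Fin k → ℤ) →
    ∃ λ (c : Fin l → ℤ) → (∀ j → parity (sumℤ (λ i → c i * A i j)) ≡ false) × ∃ λ i → parity (c i) ≡ true
  leftKernel {k} {l} k<l A
    with pigeonhole (ℕ.^-monoʳ-< 2 (ℕ.s≤s (ℕ.s≤s ℕ.z≤n)) k<l)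
           (λ a → funToFin (λ j → unbit (parity (sumℤ (λ i → ⟦ bit (finToFun {2} {l} a i) ⟧ * A i j)))))
  ... | a , a′ , a<a′ , fa≡fa′ = c , even , odd
    where
    open ≡-Reasoning
    e e′ c : Fin l → ℤ
    e  i = ⟦ bit (finToFun {2} {l} a i) ⟧
    e′ i = ⟦ bit (finToFun {2} {l} a′ i) ⟧
    c  i = (- 1ℤ) * e′ i + e i

    same : ∀ j → parity (sumℤ (λ i → e i * A i j)) ≡ parity (sumℤ (λ i → e′ i * A i j))
    same j = unbit-injective (trans (sym (finToFun-funToFin (λ j → unbit (parity (sumℤ
        (λ i → e i * A i j)))) j))
      (trans (cong (λ z → finToFun {2} {k} z j) fa≡fa′) (finToFun-funToFin (λ j → unbit (parity (sumℤ
          (λ i → e′ i * A i j)))) j)))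

    c-parity : ∀ i → parity (c i) ≡ bit (finToFun {2} {l} a′ i) xor bit (finToFun {2} {l} a i)
    c-parity i = trans (parity-+ ((- 1ℤ) * e′ i) (e i))
      (cong₂ _xor_ (trans (parity-* (- 1ℤ) (e′ i)) (parity-⟦⟧ (bit (finToFun {2} {l} a′ i))))
          (parity-⟦⟧ (bit (finToFun {2} {l} a i))))

    expand : ∀ x y z → ((- 1ℤ) * x + y) * z ≡ (- 1ℤ) * (x * z) + y * z
    expand = solve-∀

    even : ∀ j → parity (sumℤ (λ i → c i * A i j)) ≡ false
    even j = begin
      parity (sumℤ (λ i → c i * A i j))
        ≡⟨ cong parity (sum-cong (λ i → expand (e′ i) (e i) (A i j))) ⟩
      parity (sumℤ (λ i → (- 1ℤ) * (e′ i * A i j) + e i * A i j))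
        ≡⟨ cong parity (sum-linear (- 1ℤ) (λ i → e′ i * A i j) (λ i → e i * A i j)) ⟩
      parity ((- 1ℤ) * s′ + s)              ≡⟨ parity-+ ((- 1ℤ) * s′) s ⟩
      parity ((- 1ℤ) * s′) xor parity s     ≡⟨ cong₂ _xor_ (parity-* (- 1ℤ) s′) (same j) ⟩
      parity s′ xor parity s′               ≡⟨ xor-same (parity s′) ⟩
      false                                 ∎
      where
      s  = sumℤ (λ i → e i * A i j)
      s′ = sumℤ (λ i → e′ i * A i j)

    odd : ∃ λ i → parity (c i) ≡ true
    odd with ¬∀⟶∃¬ l (λ i → finToFun {2} {l} a i ≡ finToFun {2} {l} a′ i)
        (λ i → finToFun {2} {l} a i Fin.≟ finToFun {2} {l} a′ i)
              (λ all → Fin.<⇒≢ a<a′ (trans (sym (funToFin-finToFin {l} {2} a)) (trans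
                  (funToFin-cong all) (funToFin-finToFin {l} {2} a′))))
    ... | i , bits≢ = i , trans (c-parity i) (differ _ _ (λ eq → bits≢ (sym (bit-injective eq))))
      where
      differ : ∀ x y → x ≢ y → x xor y ≡ true
      differ true  true  x≢y = contradiction refl x≢y
      differ true  false _   = refl
      differ false true  _   = refl
      differ false false x≢y = contradiction refl x≢y

  -- The combination k is a separate argument, equal to a f + g only pointwise; this replaces
  -- function extensionality, since a = 0 gives invariance under pointwise equality.
  LinearFunctional : ∀ {v} → ((Fin v → ℤ) → ℤ) → Set
  LinearFunctional Λ = ∀ a {f g k} → (∀ x → k x ≡ a * f x + g x) → Λ k ≡ a * Λ f + Λ g

  functional-sum : ∀ {v k} {Λ : (Fin v → ℤ) → ℤ} → LinearFunctional Λ → ∀ (c : Fin k → ℤ)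
      (F : Fin k → Fin v → ℤ) →
                   Λ (λ x → sumℤ (λ i → c i * F i x)) ≡ sumℤ (λ i → c i * Λ (F i))
  functional-sum {v} {zero} {Λ} Λ-lin c F =
    trans (Λ-lin (- 1ℤ) {λ _ → 0ℤ} {λ _ → 0ℤ} (λ _ → refl)) (cancel (Λ (λ _ → 0ℤ)))
    where
    cancel : ∀ z → (- 1ℤ) * z + z ≡ 0ℤ
    cancel = solve-∀
  functional-sum {v} {suc k} {Λ} Λ-lin c F = trans
    (Λ-lin (c Fin.zero) {F Fin.zero} {λ x → sumℤ (λ i → c (Fin.suc i) * F (Fin.suc i) x)} (λ _ → refl))
    (cong (λ z → c Fin.zero * Λ (F Fin.zero) + z) (functional-sum {Λ = Λ} Λ-lin (λ i → c (Fin.suc i))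
        (λ i → F (Fin.suc i))))

  unit : ∀ {v} → Fin v → Fin v → ℤ
  unit y x = indicator (y Fin.≟ x) 1ℤ

  sum-unit : ∀ {v} (x : Fin v) (f : Fin v → ℤ) → sumℤ (λ y → f y * unit x y) ≡ f x
  sum-unit x f = trans (sum-cong (λ y → trans (*-comm (f y) (unit x y))
      (trans (indicator-* (x Fin.≟ y) 1ℤ (f y)) (cong (indicator (x Fin.≟ y)) (*-identityˡ (f y))))))
    (sum-indicator x f)

  unit-sym : ∀ {v} (x y : Fin v) → unit x y ≡ unit y x
  unit-sym x y = indicator-cong (x Fin.≟ y) (y Fin.≟ x) sym sym (λ _ → refl)

  sum-unit′ : ∀ {v} (x : Fin v) (f : Fin v → ℤ) → sumℤ (λ y → f y * unit y x) ≡ f x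
  sum-unit′ x f = trans (sum-cong (λ y → cong (λ z → f y * z) (unit-sym y x))) (sum-unit x f)

  dot-linear : ∀ {v} (l : Fin v → ℤ) → LinearFunctional (λ f → sumℤ (λ x → l x * f x))
  dot-linear l a {f} {g} k≡ = trans
    (sum-cong (λ x → trans (cong (λ z → l x * z) (k≡ x)) (regroup (l x) a (f x) (g x))))
    (sum-linear a (λ x → l x * f x) (λ x → l x * g x))
    where
    regroup : ∀ l a x y → l * (a * x + y) ≡ a * (l * x) + l * y
    regroup = solve-∀

  -- Double-negation shift, valid constructively because the index set is finite.
  ¬¬-∀ : ∀ {v} {P : Fin v → Set} → (∀ x → ¬ ¬ P x) → ¬ ¬ (∀ x → P x)
  ¬¬-∀ {zero}  _    ¬all = ¬all λ ()
  ¬¬-∀ {suc v} ¬¬P  ¬all = ¬¬P Fin.zero λ p₀ → ¬¬-∀ (λ x → ¬¬P (Fin.suc x)) λ ps →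
    ¬all λ { Fin.zero → p₀ ; (Fin.suc x) → ps x }

  -- The rank is that of `L₀`, while the block form belongs to `L`; they agree mod 2. Since `L` is
  -- symmetric, a combination of its rows is the image of the vector `span s c`, so independence of
  -- rows becomes a statement about the kernel of `L` mod 2.
  module Rank {v N : ℕ} {L L₀ : Fin v → Fin v → ℤ}
    (L-sym : ∀ x y → L x y ≡ L y x) (L≡L₀ : ∀ x y → parity (L₀ x y) ≡ parity (L x y))
    (D : BlockDiagonal N L) where
    open BlockDiagonal D
    module Sm i = SmithBlock (block i)
    open Split (split Sm.doubled) using ()
      renaming (n to k; embed-false to simple; class to class;
                p-false to is-simple; p-true to is-double; class-false to class-simple;
                embed-class to embed-class)

    ρ : (Fin v → ℤ) → Fin n → ℤ
    ρ f i = Sm.ρ i (X f i) (Y f i)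

    ρ-linear : ∀ i → LinearFunctional (λ f → ρ f i)
    ρ-linear i a {f} {g} h≡ = trans (cong₂ (Sm.ρ i) (X-linear a h≡ i) (Y-linear a h≡ i))
                            (Sm.ρ-linear i a (X f i) (Y f i) (X g i) (Y g i))

    Even : ∀ {k} → (Fin k → ℤ) → Set
    Even f = ∀ x → parity (f x) ≡ false

    twice : ∀ x → + 2 * x ≡ 1ℤ * x + x
    twice = solve-∀

    parity-twice : ∀ x → parity (1ℤ * x + x) ≡ false
    parity-twice x = trans (cong parity (sym (twice x))) (parity-double x)

    -- Writing f = 2 w gives Λ f = 2 Λ w; the double appears as 1 · w + w to fit the shape of
    -- `LinearFunctional`.
    even-coordinates : ∀ {Λ} → LinearFunctional {v} Λ → ∀ f → Even f → parity (Λ f) ≡ false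
    even-coordinates {Λ} Λ-lin f even = trans
      (cong parity (Λ-lin 1ℤ {w} {w} {f} (λ x → trans (proj₂ (even⇒double (f x) (even x))) (twice
          (w x)))))
      (parity-twice (Λ w))
      where
      w : Fin v → ℤ
      w x = proj₁ (even⇒double (f x) (even x))

    -- Halving all coordinates defines a w whose double has the coordinates of f, hence equals f by
    -- injectivity.
    coordinates-even : ∀ f → Even (X f) → Even (Y f) → Even f
    coordinates-even f X-even Y-even x = trans (cong parity (injective f
        (λ x → 1ℤ * w x + w x) X≡ Y≡ x)) (parity-twice (w x))
      where
      half : (f : Fin n → ℤ) → Even f → Fin n → ℤ
      half f even i = proj₁ (even⇒double (f i) (even i))
      w : Fin v → ℤ
      w = point (half (X f) X-even) (half (Y f) Y-even)
      X≡ : ∀ i → X f i ≡ X (λ x → 1ℤ * w x + w x) i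
      X≡ i = trans (trans (proj₂ (even⇒double (X f i) (X-even i))) (twice (half (X f) X-even i)))
        (sym (trans (X-linear 1ℤ {w} {w} (λ _ → refl) i) (cong (λ z → 1ℤ * z + z) (X-point _ _ i))))
      Y≡ : ∀ i → Y f i ≡ Y (λ x → 1ℤ * w x + w x) i
      Y≡ i = trans (trans (proj₂ (even⇒double (Y f i) (Y-even i))) (twice (half (Y f) Y-even i)))
        (sym (trans (Y-linear 1ℤ {w} {w} (λ _ → refl) i) (cong (λ z → 1ℤ * z + z) (Y-point _ _ i))))

    image-even⇒ρ-even : ∀ f → Even (matVec L f) → Even (ρ f)
    image-even⇒ρ-even f even i = Sm.rows-even⇒ρ-even i (X f i) (Y f i)
      (trans (cong parity (sym (X-L f i))) (even-coordinates {λ f → X f i} (λ a h≡ → X-linear a h≡ i)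
          (matVec L f) even))
      (trans (cong parity (sym (Y-L f i))) (even-coordinates {λ f → Y f i} (λ a h≡ → Y-linear a h≡ i)
          (matVec L f) even))

    -- With `image-even⇒ρ-even` this says that the kernel of `L` mod 2 is cut out by the forms ρ of
    -- the k blocks with g = 1; in the other blocks ρ is even anyway.
    ρ-even⇒image-even : ∀ f → Even (λ j → ρ f (simple j)) → Even (matVec L f)
    ρ-even⇒image-even f even = coordinates-even (matVec L f)
      (λ i → trans (cong parity (X-L f i)) (Sm.ρ-even⇒row₁-even i (X f i) (Y f i) (ρ-even i)))
      (λ i → trans (cong parity (Y-L f i)) (Sm.ρ-even⇒row₂-even i (X f i) (Y f i) (ρ-even i)))
      where
      ρ-even : Even (ρ f)
      ρ-even i with class i | embed-class i
      ... | inj₁ j | refl = even j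
      ... | inj₂ j | refl = Sm.doubled⇒ρ-even i (X f i) (Y f i) (is-double j)

    span : ∀ {l} → (Fin l → Fin v) → (Fin l → ℤ) → Fin v → ℤ
    span s c x = sumℤ (λ i → c i * unit (s i) x)

    image-span : ∀ {l} (s : Fin l → Fin v) c y → matVec L (span s c) y ≡ sumℤ (λ i → c i * L (s i) y)
    image-span s c y = trans
      (functional-sum {Λ = λ f → matVec L f y} (dot-linear (L y)) c (λ i → unit (s i)))
      (sum-cong (λ i → cong (λ z → c i * z) (trans (sum-unit (s i) (L y)) (L-sym y (s i)))))

    rows-sum : ∀ {l} (s : Fin l → Fin v) (c : Fin l → ℤ) y →
               sumF₂ (λ i → parity (c i) ∧ mod2 L₀ (s i) y) ≡ parity (matVec L (span s c) y)
    rows-sum s c y = sym (trans (cong parity (image-span s c y)) (trans (parity-sum (λ i → c i * L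
        (s i) y))
      (sumF₂-cong (λ i → trans (parity-* (c i) (L (s i) y)) (cong (λ z → parity (c i) ∧ z) (sym (L≡L₀
          (s i) y)))))))

    independent : ∀ {l} {s : Fin l → Fin v} → LinIndepF₂ (λ i → mod2 L₀ (s i)) →
                  ∀ c → Even (matVec L (span s c)) → Even c
    independent {s = s} indep c even = indep (λ i → parity (c i)) (λ y → trans (rows-sum s c y) (even y))

    -- More than k rows admit a combination, not trivial mod 2, on which all k forms ρ are even. Its
    -- image under `L` is then even, which contradicts independence.
    independent⇒≤ : ∀ {l} {s : Fin l → Fin v} → LinIndepF₂ (λ i → mod2 L₀ (s i)) → l ℕ.≤ k
    independent⇒≤ {l} {s} indep with l ℕ.≤? k
    ... | yes l≤k = l≤k
    ... | no  l≰k = contradiction (trans (sym (proj₂ odd)) (independent indep c image-even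
        (proj₁ odd))) λ ()
      where
      kernel = leftKernel (ℕ.≰⇒> l≰k) (λ i j → ρ (unit (s i)) (simple j))
      c = proj₁ kernel
      even = proj₁ (proj₂ kernel)
      odd = proj₂ (proj₂ kernel)
      image-even : Even (matVec L (span s c))
      image-even = ρ-even⇒image-even (span s c) λ j → trans
        (cong parity (functional-sum {Λ = λ f → ρ f (simple j)} (ρ-linear (simple j)) c (λ i → unit
            (s i))))
        (even j)

    Dependence : ∀ {l} → (Fin l → Fin v) → Fin v → Set
    Dependence {l} s x = ∃ λ (a : Fin l → ℤ) → ∀ y → parity (L y x) ≡ parity (matVec L (span s a) y)

    extend : ∀ {l} {A : Set} → A → (Fin l → A) → Fin (suc l) → A
    extend x s Fin.zero    = x
    extend x s (Fin.suc i) = s i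

    -- Maximality of an independent set yields relations only up to ¬¬, which suffices for the
    -- decidable conclusion of rank≡.
    dependence : ∀ {l} {s : Fin l → Fin v} → LinIndepF₂ (λ i → mod2 L₀ (s i)) → ∀ x →
                 ¬ LinIndepF₂ (λ i → mod2 L₀ (extend x s i)) → ¬ ¬ Dependence s x
    dependence {l} {s} indep x ¬indep ¬dep = ¬indep λ c rel → trivial c rel (c Fin.zero) refl
      where
      trivial : ∀ (c : Fin (suc l) → Bool) → (∀ y → sumF₂ (λ i → c i ∧ mod2 L₀
          (extend x s i) y) ≡ false) →
                ∀ c₀ → c Fin.zero ≡ c₀ → ∀ i → c i ≡ false
      trivial c rel false c₀ Fin.zero    = c₀
      trivial c rel false c₀ (Fin.suc i) = indep (λ i → c (Fin.suc i)) (λ y →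
        trans (sym (cong (λ b → (b ∧ mod2 L₀ x y) xor sumF₂ (λ i → c (Fin.suc i) ∧ mod2 L₀
            (s i) y)) c₀)) (rel y)) i
      trivial c rel true  c₀ i = contradiction ((λ i → ⟦ c (Fin.suc i) ⟧) , λ y → begin
          parity (L y x)    ≡⟨ trans (cong parity (L-sym y x)) (sym (L≡L₀ x y)) ⟩
          mod2 L₀ x y       ≡⟨ xor-false (mod2 L₀ x y) _ (trans (sym (cong (λ b →
              (b ∧ mod2 L₀ x y) xor sumF₂ (λ i → c (Fin.suc i) ∧ mod2 L₀ (s i) y)) c₀)) (rel y)) ⟩
          sumF₂ (λ i → c (Fin.suc i) ∧ mod2 L₀ (s i) y)
            ≡⟨ sumF₂-cong (λ i → cong (λ b → b ∧ mod2 L₀ (s i) y) (sym (parity-⟦⟧ (c (Fin.suc i))))) ⟩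
          sumF₂ (λ i → parity ⟦ c (Fin.suc i) ⟧ ∧ mod2 L₀ (s i) y)
            ≡⟨ rows-sum s (λ i → ⟦ c (Fin.suc i) ⟧) y ⟩
          parity (matVec L (span s (λ i → ⟦ c (Fin.suc i) ⟧)) y) ∎) ¬dep
        where
        open ≡-Reasoning
        xor-false : ∀ a b → a xor b ≡ false → a ≡ b
        xor-false true  true  _ = refl
        xor-false false false _ = refl

    -- Vectors dual to the k forms ρ: in its own block the coordinates (u′ , u) give ρ the value 1,
    -- and all other coordinates are 0. They witness that the k forms are independent.
    dual : Fin k → Fin v → ℤ
    dual j = point (λ i → coefficient i * Sm.u′ i) (λ i → coefficient i * Sm.u i)
      where
      coefficient : Fin n → ℤ
      coefficient i = [ unit j , (λ _ → 0ℤ) ]′ (class i)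

    ρ-dual : ∀ j j′ → ρ (dual j) (simple j′) ≡ unit j j′
    ρ-dual j j′ = trans (cong₂ (Sm.ρ (simple j′)) (X-point _ _ (simple j′)) (Y-point _ _ (simple j′)))
      (trans (Sm.ρ-section (simple j′) _ (is-simple j′)) (cong [ unit j , (λ _ → 0ℤ) ]′
          (class-simple j′)))

    -- If l columns span all columns mod 2, then `L` mod 2 factors through l coefficients. For l < k
    -- some combination w of the dual vectors, not trivial mod 2, has all these coefficients even;
    -- then L w is even, hence so is every ρ of w, and these values are the coefficients of the
    -- combination.
    spanning⇒≤ : ∀ {l} {s : Fin l → Fin v} → (∀ x → Dependence s x) → k ℕ.≤ l
    spanning⇒≤ {l} {s} dep with k ℕ.≤? l
    ... | yes k≤l = k≤l
    ... | no  k≰l = contradiction (trans (sym (proj₂ odd)) (c-even (proj₁ odd))) λ ()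
      where
      kernel = leftKernel (ℕ.≰⇒> k≰l) (λ j i → sumℤ (λ x → proj₁ (dep x) i * dual j x))
      c = proj₁ kernel
      even = proj₁ (proj₂ kernel)
      odd = proj₂ (proj₂ kernel)
      open ≡-Reasoning
      a : Fin v → Fin l → ℤ
      a x = proj₁ (dep x)
      w : Fin v → ℤ
      w x = sumℤ (λ j → c j * dual j x)

      coefficient-even : ∀ i → parity (sumℤ (λ x → a x i * w x)) ≡ false
      coefficient-even i = trans (cong parity
        (functional-sum {Λ = λ f → sumℤ (λ x → a x i * f x)} (dot-linear (λ x → a x i)) c dual)) (even i)

      -- Mod 2 each column x of `L` is replaced by its combination of the columns s i. Exchanging
      -- the sums leaves the column s i multiplied by the sum of the a x i * w x over x, which is
      -- even.
      image-even : Even (matVec L w)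
      image-even y = begin
        parity (sumℤ (λ x → L y x * w x))
          ≡⟨ trans (parity-sum (λ x → L y x * w x)) (sumF₂-cong (λ x → trans (parity-* (L y x) (w x))
               (trans (cong (λ b → b ∧ parity (w x)) (proj₂ (dep x) y)) (sym (parity-* (matVec L
                   (span s (a x)) y) (w x))))))
           ⟩
        sumF₂ (λ x → parity (matVec L (span s (a x)) y * w x))
          ≡⟨ parity-sum (λ x → matVec L (span s (a x)) y * w x) ⟨
        parity (sumℤ (λ x → matVec L (span s (a x)) y * w x))
          ≡⟨ cong parity (sum-cong (λ x → trans (cong (λ z → z * w x) (image-span s (a x) y)) (trans
              (*-comm (sumℤ (λ i → a x i * L (s i) y)) (w x))
               (trans (sym (*-distribˡ-sum (w x) (λ i → a x i * L (s i) y))) (sum-cong (λ i → regroup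
                   (w x) (a x i) (L (s i) y))))))) ⟩
        parity (sumℤ (λ x → sumℤ (λ i → L (s i) y * (a x i * w x))))
          ≡⟨ cong parity (trans (sum-swap (λ x i → L (s i) y * (a x i * w x)))
               (sum-cong (λ i → *-distribˡ-sum (L (s i) y) (λ x → a x i * w x)))) ⟩
        parity (sumℤ (λ i → L (s i) y * sumℤ (λ x → a x i * w x)))
          ≡⟨ parity-sum-even _ (λ i → trans (parity-* (L (s i) y) (sumℤ (λ x → a x i * w x)))
               (trans (cong (λ b → parity (L (s i) y) ∧ b) (coefficient-even i)) (∧-zeroʳ (parity (L
                   (s i) y))))) ⟩
        false ∎
        where
        regroup : ∀ w a l → w * (a * l) ≡ l * (a * w)
        regroup = solve-∀

      c-even : ∀ j → parity (c j) ≡ false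
      c-even j = begin
        parity (c j)                                          ≡⟨ cong parity (sum-unit′ j c) ⟨
        parity (sumℤ (λ i → c i * unit i j))                  ≡⟨ cong parity (sum-cong (λ i → cong
            (λ z → c i * z) (ρ-dual i j))) ⟨
        parity (sumℤ (λ i → c i * ρ (dual i) (simple j)))
          ≡⟨ cong parity (functional-sum {Λ = λ f → ρ f (simple j)} (ρ-linear (simple j)) c dual) ⟨
        parity (ρ w (simple j))                               ≡⟨ image-even⇒ρ-even w image-even
            (simple j) ⟩
        false ∎

    rank≡ : ∀ r → RankF₂ (mod2 L₀) r → r ≡ k
    rank≡ r ((s , indep) , maximal) = ℕ.≤-antisym (independent⇒≤ indep)
      (decidable-stable (k ℕ.≤? r) (¬¬-map spanning⇒≤
        (¬¬-∀ (λ x → dependence indep x (maximal (extend x s))))))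

  -- Diagonalising a pair of mutually inverse maps (up to the factor N)

  linear-⊕ : ∀ {m n} {f : Vec ℤ m → Vec ℤ n} → Linear f → ∀ x y i →
             lookup (f (x ⊕ y)) i ≡ lookup (f x) i + lookup (f y) i
  linear-⊕ {f = f} f-lin x y i = begin
    lookup (f (x ⊕ y)) i                    ≡⟨ cong (λ u → lookup (f (u ⊕ y)) i) (1⋆ x) ⟨
    lookup (f (1ℤ ⋆ x ⊕ y)) i               ≡⟨ cong (λ u → lookup u i) (f-lin 1ℤ x y) ⟩
    lookup (1ℤ ⋆ f x ⊕ f y) i               ≡⟨ lookup-⋆⊕ 1ℤ (f x) (f y) i ⟩
    1ℤ * lookup (f x) i + lookup (f y) i    ≡⟨ cong (λ z → z + lookup (f y) i) (*-identityˡ (lookup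
        (f x) i)) ⟩
    lookup (f x) i + lookup (f y) i         ∎
    where
    open ≡-Reasoning
    1⋆ : ∀ {n} (x : Vec ℤ n) → 1ℤ ⋆ x ≡ x
    1⋆ x = vec-ext λ i → trans (lookup-⋆ 1ℤ x i) (*-identityˡ (lookup x i))

  record DiagonalPair {n : ℕ} (N : ℤ) (B B′ : Vec ℤ n → Vec ℤ n) : Set where
    field
      U V       : Aut n
      b b′      : Fin n → ℤ
      block     : ∀ i → SmithBlock N (b i) (b′ i)
      diagonal  : ∀ y i → lookup (to U (B y)) i ≡ b i * lookup (to V y) i
      diagonal′ : ∀ x i → lookup (to V (B′ x)) i ≡ b′ i * lookup (to U x) i

  -- Only B needs diagonalising: B′ is N B⁻¹ and becomes diagonal in the same two bases. The pair C
  -- , C′ is not diagonalised; only its diagonal entries in these bases are used.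
  diagonalisePair : ∀ {n} N → N ≢ 0ℤ → (B B′ C C′ : Vec ℤ n → Vec ℤ n) → Linear B → Linear C →
    (∀ x → B (B′ x) ≡ N ⋆ x) → (∀ x → C (B′ x) ⊕ B (C′ x) ≡ + 2 ⋆ x) → DiagonalPair N B B′
  diagonalisePair {n} N N≢0 B B′ C C′ B-lin C-lin BB′ CB′+BC′ = record
    { U = U ; V = V ; b = b ; b′ = b′
    ; block = λ i → smithBlock (mkBlock N (b i) (b′ i) (β i) (β′ i) (bb′≡N i) (β-eq i))
    ; diagonal = diagonal ; diagonal′ = diagonal′ }
    where
    open Diagonal (diagonalise B B-lin N N≢0 (λ x → B′ x , BB′ x)) renaming (d to b)
    open ≡-Reasoning

    E W : Fin n → Vec ℤ n
    E i = tabulate (unit i)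
    W i = from U (E i)

    -- The (i , i) entries of V B′ U⁻¹, V C′ U⁻¹ and U C V⁻¹, where `W i` is the i-th column of U⁻¹.
    b′ β β′ : Fin n → ℤ
    b′ i = lookup (to V (B′ (W i))) i
    β  i = lookup (to V (C′ (W i))) i
    β′ i = lookup (to U (C (from V (E i)))) i

    E-diag : ∀ i → lookup (E i) i ≡ 1ℤ
    E-diag i = trans (lookup∘tabulate (unit i) i) (indicator-yes (i Fin.≟ i) refl)

    U-W : ∀ i j → lookup (to U (W i)) j ≡ lookup (E i) j
    U-W i j = cong (λ u → lookup u j) (to-from U (E i))

    b-VB′ : ∀ x i → b i * lookup (to V (B′ x)) i ≡ N * lookup (to U x) i
    b-VB′ x i = begin
      b i * lookup (to V (B′ x)) i   ≡⟨ diagonal (B′ x) i ⟨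
      lookup (to U (B (B′ x))) i     ≡⟨ cong (λ u → lookup (to U u) i) (BB′ x) ⟩
      lookup (to U (N ⋆ x)) i        ≡⟨ cong (λ u → lookup u i) (linear-⋆ {f = to U} (linear U) N x) ⟩
      lookup (N ⋆ to U x) i          ≡⟨ lookup-⋆ N (to U x) i ⟩
      N * lookup (to U x) i          ∎

    bb′≡N : ∀ i → b i * b′ i ≡ N
    bb′≡N i = begin
      b i * b′ i                   ≡⟨ b-VB′ (W i) i ⟩
      N * lookup (to U (W i)) i    ≡⟨ cong (λ z → N * z) (trans (U-W i i) (E-diag i)) ⟩
      N * 1ℤ                       ≡⟨ *-identityʳ N ⟩
      N                            ∎

    diagonal′ : ∀ x i → lookup (to V (B′ x)) i ≡ b′ i * lookup (to U x) i
    -- Both sides agree after multiplication by b i, which is nonzero as a factor of N.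
    diagonal′ x i = *-cancelˡ-≡ (b i) _ _ {{≢-nonZero b≢0}} (begin
      b i * lookup (to V (B′ x)) i        ≡⟨ b-VB′ x i ⟩
      N * lookup (to U x) i               ≡⟨ cong (λ z → z * lookup (to U x) i) (bb′≡N i) ⟨
      b i * b′ i * lookup (to U x) i      ≡⟨ *-assoc (b i) (b′ i) (lookup (to U x) i) ⟩
      b i * (b′ i * lookup (to U x) i)    ∎)
      where
      b≢0 : b i ≢ 0ℤ
      b≢0 b≡0 = N≢0 (trans (sym (bb′≡N i)) (cong (λ z → z * b′ i) b≡0))

    B′W : ∀ i → B′ (W i) ≡ b′ i ⋆ from V (E i)
    B′W i = begin
      B′ (W i)                         ≡⟨ from-to V (B′ (W i)) ⟨
      from V (to V (B′ (W i)))         ≡⟨ cong (from V) (vec-ext entry) ⟩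
      from V (b′ i ⋆ E i)              ≡⟨ linear-⋆ {f = from V} (from-linear V) (b′ i) (E i) ⟩
      b′ i ⋆ from V (E i)              ∎
      where
      off-diagonal : ∀ j → b′ j * unit i j ≡ b′ i * unit i j
      off-diagonal j with i Fin.≟ j
      ... | yes refl = refl
      ... | no  _    = trans (*-zeroʳ (b′ j)) (sym (*-zeroʳ (b′ i)))
      entry : ∀ j → lookup (to V (B′ (W i))) j ≡ lookup (b′ i ⋆ E i) j
      entry j = begin
        lookup (to V (B′ (W i))) j         ≡⟨ diagonal′ (W i) j ⟩
        b′ j * lookup (to U (W i)) j       ≡⟨ cong (λ z → b′ j * z) (trans (U-W i j) (lookup∘tabulate
            (unit i) j)) ⟩
        b′ j * unit i j                    ≡⟨ off-diagonal j ⟩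
        b′ i * unit i j                    ≡⟨ cong (λ z → b′ i * z) (lookup∘tabulate (unit i) j) ⟨
        b′ i * lookup (E i) j              ≡⟨ lookup-⋆ (b′ i) (E i) j ⟨
        lookup (b′ i ⋆ E i) j              ∎

    UCB′W : ∀ i → lookup (to U (C (B′ (W i)))) i ≡ β′ i * b′ i
    UCB′W i = begin
      lookup (to U (C (B′ (W i)))) i                ≡⟨ cong (λ u → lookup (to U (C u)) i) (B′W i) ⟩
      lookup (to U (C (b′ i ⋆ from V (E i)))) i
        ≡⟨ cong (λ u → lookup u i) (linear-⋆ {f = λ x → to U (C x)} (∘-linear {f = to U} {C}
            (linear U) C-lin) (b′ i) (from V (E i))) ⟩
      lookup (b′ i ⋆ to U (C (from V (E i)))) i     ≡⟨ lookup-⋆ (b′ i) (to U (C (from V (E i)))) i ⟩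
      b′ i * β′ i                                   ≡⟨ *-comm (b′ i) (β′ i) ⟩
      β′ i * b′ i                                   ∎

    -- Compare the (i , i) entries of C B′ + B C′ = 2 in the basis of U. Since B and B′ are
    -- diagonal, each product contributes a single term.
    β-eq : ∀ i → β i * b i + β′ i * b′ i ≡ + 2
    β-eq i = begin
      β i * b i + β′ i * b′ i
        ≡⟨ cong₂ _+_ (trans (*-comm (β i) (b i)) (sym (diagonal (C′ (W i)) i))) (sym (UCB′W i)) ⟩
      lookup (to U (B (C′ (W i)))) i + lookup (to U (C (B′ (W i)))) i
        ≡⟨ +-comm (lookup (to U (B (C′ (W i)))) i) (lookup (to U (C (B′ (W i)))) i) ⟩
      lookup (to U (C (B′ (W i)))) i + lookup (to U (B (C′ (W i)))) i
        ≡⟨ linear-⊕ {f = to U} (linear U) (C (B′ (W i))) (B (C′ (W i))) i ⟨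
      lookup (to U (C (B′ (W i)) ⊕ B (C′ (W i)))) i
        ≡⟨ cong (λ u → lookup (to U u) i) (CB′+BC′ (W i)) ⟩
      lookup (to U (+ 2 ⋆ W i)) i
        ≡⟨ cong (λ u → lookup u i) (linear-⋆ {f = to U} (linear U) (+ 2) (W i)) ⟩
      lookup (+ 2 ⋆ to U (W i)) i
        ≡⟨ lookup-⋆ (+ 2) (to U (W i)) i ⟩
      + 2 * lookup (to U (W i)) i
        ≡⟨ cong (λ z → + 2 * z) (trans (U-W i i) (E-diag i)) ⟩
      + 2 ∎

  -- Balanced bipartitions of the vertex set

  record Bipartition {v : ℕ} (part : Fin v → Bool) : Set where
    field
      n         : ℕ
      v≡n+n     : v ≡ n ℕ.+ n
      even odd  : Fin n → Fin v
      part-even : ∀ i → part (even i) ≡ false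
      part-odd  : ∀ i → part (odd i) ≡ true
      find-even : ∀ x → part x ≡ false → ∃ λ i → even i ≡ x
      find-odd  : ∀ x → part x ≡ true → ∃ λ i → odd i ≡ x
      join      : (Fin n → ℤ) → (Fin n → ℤ) → Fin v → ℤ
      join-even : ∀ p q i → join p q (even i) ≡ p i
      join-odd  : ∀ p q i → join p q (odd i) ≡ q i

    cover : ∀ {f g : Fin v → ℤ} → (∀ i → f (even i) ≡ g (even i)) → (∀ i → f (odd i) ≡ g
        (odd i)) → ∀ x → f x ≡ g x
    cover {f} {g} on-even on-odd x = by-part (part x) refl
      where
      by-part : ∀ b → part x ≡ b → f x ≡ g x
      by-part false px with find-even x px
      ... | i , refl = on-even i
      by-part true px with find-odd x px
      ... | i , refl = on-odd i

  balanced : ∀ {v} {part : Fin v → Bool} (H : Split part) → Split.n H ≡ Split.m H → Bipartition part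
  balanced {v} {part} H@(record { n = n ; m = .n ; embed-false = e ; embed-true = o ; class = class }) refl = record
    { n = n ; v≡n+n = sym H.size ; even = e ; odd = o ; part-even = H.p-false ; part-odd = H.p-true
    ; find-even = H.find-false ; find-odd = H.find-true
    ; join = λ p q x → [ p , q ]′ (class x)
    ; join-even = λ p q i → cong [ p , q ]′ (H.class-false i)
    ; join-odd = λ p q i → cong [ p , q ]′ (H.class-true i)
    }
    where module H = Split H

  -- The involution maps each half injectively into the other. For an Adinkra it is the perfect
  -- matching formed by one colour.
  involution⇒balanced : ∀ {v} {part : Fin v → Bool} (H : Split part) (τ : Fin v → Fin v) →
    (∀ x → τ (τ x) ≡ x) → (∀ x → part (τ x) ≢ part x) → Split.n H ≡ Split.m H
  involution⇒balanced {part = part} H τ τ-invol flips = ℕ.≤-antisym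
    (Fin.injective⇒≤ {f = forth} λ {i} {j} eq → embed-false-injective
       (τ-injective (trans (sym (proj₂ (forth′ i))) (trans (cong embed-true eq) (proj₂ (forth′ j))))))
    (Fin.injective⇒≤ {f = back} λ {i} {j} eq → embed-true-injective
       (τ-injective (trans (sym (proj₂ (back′ i))) (trans (cong embed-false eq) (proj₂ (back′ j))))))
    where
    open Split H
    τ-injective : ∀ {x y} → τ x ≡ τ y → x ≡ y
    τ-injective {x} {y} eq = trans (sym (τ-invol x)) (trans (cong τ eq) (τ-invol y))
    embed-false-injective : ∀ {i j} → embed-false i ≡ embed-false j → i ≡ j
    embed-false-injective {i} {j} eq = inj₁-injective (trans (sym (class-false i)) (trans
        (cong class eq) (class-false j)))
    embed-true-injective : ∀ {i j} → embed-true i ≡ embed-true j → i ≡ j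
    embed-true-injective {i} {j} eq = inj₂-injective (trans (sym (class-true i)) (trans
        (cong class eq) (class-true j)))
    forth′ : ∀ i → ∃ λ j → embed-true j ≡ τ (embed-false i)
    forth′ i = find-true (τ (embed-false i)) (¬-not (λ eq → flips (embed-false i) (trans eq (sym
        (p-false i)))))
    back′ : ∀ j → ∃ λ i → embed-false i ≡ τ (embed-true j)
    back′ j = find-false (τ (embed-true j)) (¬-not (λ eq → flips (embed-true j) (trans eq (sym
        (p-true j)))))
    forth : Fin n → Fin m
    forth i = proj₁ (forth′ i)
    back : Fin m → Fin n
    back j = proj₁ (back′ j)

  -- Operators exchanging the two halves of a bipartition

  -- The field `local` says that the value at x depends only on the values on the opposite half: as
  -- a matrix the operator has zero diagonal blocks.
  record OddOperator {v : ℕ} (part : Fin v → Bool) : Set where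
    field
      apply  : (Fin v → ℤ) → Fin v → ℤ
      apply-linear : ∀ x → LinearFunctional (λ f → apply f x)
      local  : ∀ {f g} x → (∀ y → part y ≢ part x → f y ≡ g y) → apply f x ≡ apply g x

  module Halves {v : ℕ} {part : Fin v → Bool} (H : Bipartition part) where
    open Bipartition H

    evenPart oddPart : (Fin v → ℤ) → Vec ℤ n
    evenPart f = tabulate (λ i → f (even i))
    oddPart  f = tabulate (λ i → f (odd i))

    fromEven fromOdd : Vec ℤ n → Fin v → ℤ
    fromEven x = join (lookup x) (λ _ → 0ℤ)
    fromOdd  y = join (λ _ → 0ℤ) (lookup y)

    tabulate-linear : ∀ a {f g k : Fin n → ℤ} →
        (∀ i → k i ≡ a * f i + g i) → tabulate k ≡ a ⋆ tabulate f ⊕ tabulate g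
    tabulate-linear a {f} {g} {k} k≡ = vec-ext λ i → begin
      lookup (tabulate k) i                                ≡⟨ lookup∘tabulate k i ⟩
      k i                                                  ≡⟨ k≡ i ⟩
      a * f i + g i                                        ≡⟨ cong₂ (λ x y → a * x + y)
          (lookup∘tabulate f i) (lookup∘tabulate g i) ⟨
      a * lookup (tabulate f) i + lookup (tabulate g) i    ≡⟨ lookup-⋆⊕ a (tabulate f) (tabulate g) i ⟨
      lookup (a ⋆ tabulate f ⊕ tabulate g) i               ∎
      where open ≡-Reasoning

    fromOdd-linear : ∀ a x y z → fromOdd (a ⋆ x ⊕ y) z ≡ a * fromOdd x z + fromOdd y z
    fromOdd-linear a x y = cover
      (λ i → trans (join-even _ _ i) (trans (sym (trans (+-identityʳ (a * 0ℤ)) (*-zeroʳ a))) (sym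
          (cong₂ (λ p q → a * p + q) (join-even _ _ i) (join-even _ _ i)))))
      (λ i → trans (join-odd _ _ i) (trans (lookup-⋆⊕ a x y i) (sym (cong₂ (λ p q → a * p + q)
          (join-odd _ _ i) (join-odd _ _ i)))))

    opposite-even : ∀ i {y} → part y ≢ part (even i) → ∃ λ j → odd j ≡ y
    opposite-even i {y} py≢ with part y in py
    ... | true  = find-odd y py
    ... | false = contradiction (sym (part-even i)) py≢

    opposite-odd : ∀ i {y} → part y ≢ part (odd i) → ∃ λ j → even j ≡ y
    opposite-odd i {y} py≢ with part y in py
    ... | true  = contradiction (sym (part-odd i)) py≢
    ... | false = find-even y py

    module _ (P : OddOperator part) where
      open OddOperator P

      oddToEven evenToOdd : Vec ℤ n → Vec ℤ n
      oddToEven y = evenPart (apply (fromOdd y))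
      evenToOdd x = oddPart (apply (fromEven x))

      oddToEven-linear : Linear oddToEven
      oddToEven-linear a x y = tabulate-linear a (λ i → apply-linear (even i) a (fromOdd-linear a x y))

      apply-even : ∀ f i → apply f (even i) ≡ lookup (oddToEven (oddPart f)) i
      apply-even f i = sym (trans (lookup∘tabulate _ i) (local (even i) agree))
        where
        agree : ∀ y → part y ≢ part (even i) → fromOdd (oddPart f) y ≡ f y
        agree y py≢ with opposite-even i py≢
        ... | j , refl = trans (join-odd _ _ j) (lookup∘tabulate (f ∘ odd) j)

      apply-odd : ∀ f i → apply f (odd i) ≡ lookup (evenToOdd (evenPart f)) i
      apply-odd f i = sym (trans (lookup∘tabulate _ i) (local (odd i) agree))
        where
        agree : ∀ y → part y ≢ part (odd i) → fromEven (evenPart f) y ≡ f y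
        agree y py≢ with opposite-odd i py≢
        ... | j , refl = trans (join-even _ _ j) (lookup∘tabulate (f ∘ even) j)

    -- At an even vertex P sees only odd vertices, so cutting down to the odd half between the two
    -- operators changes nothing.
    oddToEven∘evenToOdd : (P Q : OddOperator part) → ∀ x i →
      lookup (oddToEven P (evenToOdd Q x)) i ≡ OddOperator.apply P (OddOperator.apply Q (fromEven x))
          (even i)
    oddToEven∘evenToOdd P Q x i = sym (apply-even P (OddOperator.apply Q (fromEven x)) i)

  open OddOperator using (apply)

  module _ {v : ℕ} {part : Fin v → Bool} (H : Bipartition part) (N : ℕ) (N≢0 : + N ≢ 0ℤ)
      (P Q : OddOperator part)
    (P² : ∀ f x → apply P (apply P f) x ≡ + N * f x)
    (QP+PQ : ∀ f x → apply Q (apply P f) x + apply P (apply Q f) x ≡ + 2 * f x)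
    (L : Fin v → Fin v → ℤ) (L≡ : ∀ f x → matVec L f x ≡ + N * f x - apply P f x) where
    private
      module P = OddOperator P
      module Q = OddOperator Q
    open Bipartition H
    open Halves H
    open ≡-Reasoning

    private
      B B′ C C′ : Vec ℤ n → Vec ℤ n
      B  = oddToEven P
      B′ = evenToOdd P
      C  = oddToEven Q
      C′ = evenToOdd Q

      BB′ : ∀ x → B (B′ x) ≡ + N ⋆ x
      BB′ x = vec-ext λ i → begin
        lookup (B (B′ x)) i                              ≡⟨ oddToEven∘evenToOdd P P x i ⟩
        P.apply (P.apply (fromEven x)) (even i)          ≡⟨ P² (fromEven x) (even i) ⟩
        + N * fromEven x (even i)                        ≡⟨ cong (λ z → + N * z) (join-even _ _ i) ⟩
        + N * lookup x i                                 ≡⟨ lookup-⋆ (+ N) x i ⟨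
        lookup (+ N ⋆ x) i                               ∎

      CB′+BC′ : ∀ x → C (B′ x) ⊕ B (C′ x) ≡ + 2 ⋆ x
      CB′+BC′ x = vec-ext λ i → begin
        lookup (C (B′ x) ⊕ B (C′ x)) i                   ≡⟨ lookup-⊕ (C (B′ x)) (B (C′ x)) i ⟩
        lookup (C (B′ x)) i + lookup (B (C′ x)) i        ≡⟨ cong₂ _+_ (oddToEven∘evenToOdd Q P x i)
            (oddToEven∘evenToOdd P Q x i) ⟩
        Q.apply (P.apply (fromEven x)) (even i) + P.apply (Q.apply (fromEven x)) (even i)
                                                         ≡⟨ QP+PQ (fromEven x) (even i) ⟩
        + 2 * fromEven x (even i)                        ≡⟨ cong (λ z → + 2 * z) (join-even _ _ i) ⟩
        + 2 * lookup x i                                 ≡⟨ lookup-⋆ (+ 2) x i ⟨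
        lookup (+ 2 ⋆ x) i                               ∎

    module _ (D : DiagonalPair (+ N) B B′) where
      open DiagonalPair D

      private
        X Y : (Fin v → ℤ) → Fin n → ℤ
        X f i = lookup (to U (evenPart f)) i
        Y f i = lookup (to V (oddPart f)) i

        image : ∀ (W : Aut n) a {f g k : Fin n → ℤ} → (∀ i → k i ≡ a * f i + g i) → ∀ i →
                lookup (to W (tabulate k)) i ≡ a * lookup (to W (tabulate f)) i + lookup (to W
                    (tabulate g)) i
        image W a {f} {g} k≡ i = trans (cong (λ u → lookup (to W u) i) (tabulate-linear a {f} {g} k≡))
          (trans (cong (λ u → lookup u i) (Aut.linear W a (tabulate f) (tabulate g)))
                 (lookup-⋆⊕ a (to W (tabulate f)) (to W (tabulate g)) i))

        point : (Fin n → ℤ) → (Fin n → ℤ) → Fin v → ℤ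
        point p q = join (lookup (from U (tabulate p))) (lookup (from V (tabulate q)))

        tabulate-entries : ∀ (W : Aut n) (f p : Fin n → ℤ) → (∀ i → f i ≡ lookup (from W
            (tabulate p)) i) →
                           ∀ i → lookup (to W (tabulate f)) i ≡ p i
        tabulate-entries W f p f≡ i = begin
          lookup (to W (tabulate f)) i
            ≡⟨ cong (λ u → lookup (to W u) i) (vec-ext (λ j → trans (lookup∘tabulate f j) (f≡ j))) ⟩
          lookup (to W (from W (tabulate p))) i   ≡⟨ cong (λ u → lookup u i) (to-from W (tabulate p)) ⟩
          lookup (tabulate p) i                   ≡⟨ lookup∘tabulate p i ⟩
          p i                                     ∎

        aut-injective : ∀ (W : Aut n) (f g : Fin n → ℤ) →
          (∀ i → lookup (to W (tabulate f)) i ≡ lookup (to W (tabulate g)) i) → ∀ i → f i ≡ g i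
        aut-injective W f g eq i = begin
          f i                                      ≡⟨ lookup∘tabulate f i ⟨
          lookup (tabulate f) i                    ≡⟨ cong (λ u → lookup u i) (from-to W (tabulate f)) ⟨
          lookup (from W (to W (tabulate f))) i    ≡⟨ cong (λ u → lookup (from W u) i) (vec-ext eq) ⟩
          lookup (from W (to W (tabulate g))) i    ≡⟨ cong (λ u → lookup u i) (from-to W (tabulate g)) ⟩
          lookup (tabulate g) i                    ≡⟨ lookup∘tabulate g i ⟩
          g i                                      ∎

        as-combination : ∀ n x y → n * x - y ≡ (- 1ℤ) * y + n * x
        as-combination = solve-∀

        L-coordinate : ∀ (W : Aut n) (h : Fin n → Fin v) (f : Fin v → ℤ) (u : Vec ℤ n) →
          (∀ i → P.apply f (h i) ≡ lookup u i) → ∀ i →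
          lookup (to W (tabulate (λ j → matVec L f (h j)))) i
            ≡ + N * lookup (to W (tabulate (f ∘ h))) i - lookup (to W u) i
        L-coordinate W h f u Pf≡u i = begin
          lookup (to W (tabulate (λ j → matVec L f (h j)))) i
            ≡⟨ image W (- 1ℤ) {lookup u} {λ j → + N * f (h j)}
                 (λ j → trans (L≡ f (h j)) (trans (cong (λ z → + N * f (h j) - z) (Pf≡u j))
                     (as-combination (+ N) (f (h j)) (lookup u j)))) i ⟩
          (- 1ℤ) * lookup (to W (tabulate (lookup u))) i + lookup (to W (tabulate (λ j → + N * f
              (h j)))) i
            ≡⟨ cong₂ (λ x y → (- 1ℤ) * lookup (to W x) i + y) (tabulate∘lookup u) (scaled i) ⟩
          (- 1ℤ) * lookup (to W u) i + + N * lookup (to W (tabulate (f ∘ h))) i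
            ≡⟨ as-combination (+ N) (lookup (to W (tabulate (f ∘ h))) i) (lookup (to W u) i) ⟨
          + N * lookup (to W (tabulate (f ∘ h))) i - lookup (to W u) i ∎
          where
          scaled : ∀ i → lookup (to W (tabulate (λ j → + N * f (h j)))) i ≡ + N * lookup (to W
              (tabulate (f ∘ h))) i
          scaled i = trans (cong (λ u → lookup (to W u) i)
              (vec-ext (λ j → trans (lookup∘tabulate _ j) (sym (trans (lookup-⋆ (+ N) (tabulate
                  (f ∘ h)) j) (cong (λ z → + N * z) (lookup∘tabulate (f ∘ h) j)))))))
            (trans (cong (λ u → lookup u i) (linear-⋆ {f = to W} (Aut.linear W) (+ N) (tabulate (f ∘ h))))
                   (lookup-⋆ (+ N) (to W (tabulate (f ∘ h))) i))

      diagonalPair⇒blockDiagonal : BlockDiagonal N L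
      diagonalPair⇒blockDiagonal = record
        { n = n ; v≡n+n = v≡n+n ; b = b ; b′ = b′ ; block = block ; X = X ; Y = Y
        ; X-linear = λ a k≡ → image U a (λ i → k≡ (even i))
        ; Y-linear = λ a k≡ → image V a (λ i → k≡ (odd i))
        ; point = point
        ; X-point = λ p q → tabulate-entries U _ p (join-even _ _)
        ; Y-point = λ p q → tabulate-entries V _ q (join-odd _ _)
        ; injective = λ f g X≡ Y≡ → cover (aut-injective U (f ∘ even) (g ∘ even) X≡) (aut-injective V
            (f ∘ odd) (g ∘ odd) Y≡)
        ; X-L = λ f i → trans (L-coordinate U even f (B (oddPart f)) (apply-even P f) i)
                              (cong (λ z → + N * X f i - z) (diagonal (oddPart f) i))
        ; Y-L = λ f i → trans (L-coordinate V odd f (B′ (evenPart f)) (apply-odd P f) i)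
                              (cong (λ z → + N * Y f i - z) (diagonal′ (evenPart f) i))
        }

    blockDiagonal : BlockDiagonal N L
    blockDiagonal = diagonalPair⇒blockDiagonal
      (diagonalisePair (+ N) N≢0 B B′ C C′ (oddToEven-linear P) (oddToEven-linear Q) BB′ CB′+BC′)

  -- Adinkras

  module _ {N v : ℕ} (A : Adinkra N v) where
    open Adinkra A

    part : Fin v → Bool
    part = proj₁ bipartite

    part-flips : ∀ c x → part (nbr c x) ≢ part x
    part-flips = proj₂ bipartite

    σ : Fin N → Fin v → ℤ
    σ c x = sgn c x ◃ 1

    colour : Fin N → (Fin v → ℤ) → Fin v → ℤ
    colour c f x = σ c x * f (nbr c x)

    adjacency : (Fin v → ℤ) → Fin v → ℤ
    adjacency f x = sumℤ (λ c → colour c f x)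

    colour-linear : ∀ c x → LinearFunctional (λ f → colour c f x)
    colour-linear c x a {f} {g} k≡ = trans (cong (λ z → σ c x * z) (k≡ (nbr c x)))
      (regroup (σ c x) a (f (nbr c x)) (g (nbr c x)))
      where
      regroup : ∀ s a x y → s * (a * x + y) ≡ a * (s * x) + s * y
      regroup = solve-∀

    adjacency-linear : ∀ x → LinearFunctional (λ f → adjacency f x)
    adjacency-linear x a {f} {g} k≡ = trans (sum-cong (λ c → colour-linear c x a {f} {g} k≡))
      (sum-linear a (λ c → colour c f x) (λ c → colour c g x))

    colourOperator : Fin N → OddOperator part
    colourOperator c = record
      { apply = colour c ; apply-linear = colour-linear c
      ; local = λ x f≡g → cong (λ z → σ c x * z) (f≡g (nbr c x) (part-flips c x)) }

    adjacencyOperator : OddOperator part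
    adjacencyOperator = record
      { apply = adjacency ; apply-linear = adjacency-linear
      ; local = λ x f≡g → sum-cong (λ c → cong (λ z → σ c x * z) (f≡g (nbr c x) (part-flips c x))) }

    colour-adjacency : ∀ c f x → colour c (adjacency f) x ≡ sumℤ (λ d → colour c (colour d f) x)
    colour-adjacency c f x = sym (*-distribˡ-sum (σ c x) (λ d → colour d f (nbr c x)))

    colour-square : ∀ c f x → colour c (colour c f) x ≡ f x
    colour-square c f x = begin
      σ c x * (σ c (nbr c x) * f (nbr c (nbr c x)))
        ≡⟨ cong₂ (λ s y → σ c x * ((s ◃ 1) * f y)) (sgn-sym c x) (nbr-invol c x) ⟩
      σ c x * (σ c x * f x)   ≡⟨ sign-square (sgn c x) (f x) ⟩
      f x                     ∎
      where
      open ≡-Reasoning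
      sign-square : ∀ s z → (s ◃ 1) * ((s ◃ 1) * z) ≡ z
      sign-square Sign.+ z = trans (*-identityˡ (1ℤ * z)) (*-identityˡ z)
      sign-square Sign.- z = go z
        where
        go : ∀ z → (- 1ℤ) * ((- 1ℤ) * z) ≡ z
        go = solve-∀

    -- The 4-cycle condition says that the composite of two involutions squares to the identity,
    -- which means that they commute.
    nbr-comm : ∀ c d x → c ≢ d → nbr d (nbr c x) ≡ nbr c (nbr d x)
    nbr-comm c d x c≢d = begin
      nbr d (nbr c x)                            ≡⟨ nbr-invol c (nbr d (nbr c x)) ⟨
      nbr c (nbr c (nbr d (nbr c x)))            ≡⟨ cong (nbr c) (nbr-invol d (nbr c (nbr d (nbr c x)))) ⟨
      nbr c (nbr d (nbr d (nbr c (nbr d (nbr c x))))) ≡⟨ cong (nbr c ∘ nbr d) (four-cycles c d x c≢d) ⟩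
      nbr c (nbr d x)                            ∎
      where open ≡-Reasoning

    -- Two of the four edges of the cycle are traversed from their far ends in `odd-neg`. Read from
    -- the other end they form the second path from x to the opposite vertex, and a negative total
    -- product makes the two path signs opposite.
    signs-anticommute : ∀ c d x → c ≢ d → σ c x * σ d (nbr c x) ≡ - (σ d x * σ c (nbr d x))
    signs-anticommute c d x c≢d = opposite (sgn c x) (sgn d (nbr c x)) (sgn c (nbr d x)) (sgn d x)
      (trans (cong₂ (λ s t → (sgn c x Sign.* sgn d (nbr c x)) Sign.* (s Sign.* t)) (sym third)
          (sym fourth)) (odd-neg c d x c≢d))
      where
      third : sgn c (nbr d (nbr c x)) ≡ sgn c (nbr d x)
      third = trans (cong (sgn c) (nbr-comm c d x c≢d)) (sgn-sym c (nbr d x))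
      fourth : sgn d (nbr c (nbr d (nbr c x))) ≡ sgn d x
      fourth = trans (cong (sgn d) (trans (cong (nbr c) (nbr-comm c d x c≢d)) (nbr-invol c
          (nbr d x)))) (sgn-sym d x)
      opposite : ∀ s t s′ t′ → (s Sign.* t) Sign.* (s′ Sign.* t′) ≡ Sign.- → (s ◃ 1) * (t ◃ 1) ≡ -
          ((t′ ◃ 1) * (s′ ◃ 1))
      opposite Sign.+ Sign.+ Sign.+ Sign.- _ = refl
      opposite Sign.+ Sign.+ Sign.- Sign.+ _ = refl
      opposite Sign.+ Sign.- Sign.+ Sign.+ _ = refl
      opposite Sign.+ Sign.- Sign.- Sign.- _ = refl
      opposite Sign.- Sign.+ Sign.+ Sign.+ _ = refl
      opposite Sign.- Sign.+ Sign.- Sign.- _ = refl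
      opposite Sign.- Sign.- Sign.+ Sign.- _ = refl
      opposite Sign.- Sign.- Sign.- Sign.+ _ = refl

    -- The Clifford relations: the signed colour operators are involutions that anticommute
    -- pairwise.
    anticommutator : ∀ c d f x → colour c (colour d f) x + colour d (colour c f) x ≡ indicator
        (c Fin.≟ d) (+ 2 * f x)
    anticommutator c d f x with c Fin.≟ d
    ... | yes refl = trans (cong (λ z → z + z) (colour-square c f x)) (double (f x))
      where
      double : ∀ z → z + z ≡ + 2 * z
      double = solve-∀
    ... | no c≢d = begin
      σ c x * (σ d (nbr c x) * f (nbr d (nbr c x))) + σ d x * (σ c (nbr d x) * f (nbr c (nbr d x)))
        ≡⟨ cong (λ y → σ c x * (σ d (nbr c x) * f y) + σ d x * (σ c (nbr d x) * f (nbr c (nbr d x))))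
            (nbr-comm c d x c≢d) ⟩
      σ c x * (σ d (nbr c x) * z) + σ d x * (σ c (nbr d x) * z)
        ≡⟨ factor (σ c x) (σ d (nbr c x)) (σ d x) (σ c (nbr d x)) z ⟩
      (σ c x * σ d (nbr c x) + σ d x * σ c (nbr d x)) * z
        ≡⟨ cong (λ w → (w + σ d x * σ c (nbr d x)) * z) (signs-anticommute c d x c≢d) ⟩
      (- (σ d x * σ c (nbr d x)) + σ d x * σ c (nbr d x)) * z
        ≡⟨ cancel (σ d x * σ c (nbr d x)) z ⟩
      0ℤ ∎
      where
      open ≡-Reasoning
      z = f (nbr c (nbr d x))
      factor : ∀ a b c d z → a * (b * z) + c * (d * z) ≡ (a * b + c * d) * z
      factor = solve-∀
      cancel : ∀ w z → (- w + w) * z ≡ 0ℤ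
      cancel = solve-∀

    colour-adjacency-anticommutator : ∀ c f x → colour c (adjacency f) x + adjacency
        (colour c f) x ≡ + 2 * f x
    colour-adjacency-anticommutator c f x = begin
      colour c (adjacency f) x + adjacency (colour c f) x
        ≡⟨ cong (λ z → z + adjacency (colour c f) x) (colour-adjacency c f x) ⟩
      sumℤ (λ d → colour c (colour d f) x) + sumℤ (λ d → colour d (colour c f) x)
        ≡⟨ sum-+ (λ d → colour c (colour d f) x) (λ d → colour d (colour c f) x) ⟨
      sumℤ (λ d → colour c (colour d f) x + colour d (colour c f) x)
        ≡⟨ sum-cong (λ d → anticommutator c d f x) ⟩
      sumℤ (λ d → indicator (c Fin.≟ d) (+ 2 * f x))
        ≡⟨ sum-indicator c (λ _ → + 2 * f x) ⟩
      + 2 * f x ∎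
      where open ≡-Reasoning

    sum-one : ∀ n → sumℤ {n} (λ _ → 1ℤ) ≡ + n
    sum-one zero    = refl
    sum-one (suc n) = cong (λ z → 1ℤ + z) (sum-one n)

    -- Summing A_c A + A A_c = 2 over the N colours gives 2 A² = 2 N, and 2 cancels in ℤ.
    adjacency-square : ∀ f x → adjacency (adjacency f) x ≡ + N * f x
    adjacency-square f x = *-cancelˡ-≡ (+ 2) _ _ (begin
      + 2 * S
        ≡⟨ double S ⟩
      S + S
        ≡⟨ cong (λ z → S + z) (functional-sum′ x) ⟩
      S + sumℤ (λ c → adjacency (colour c f) x)
        ≡⟨ sum-+ (λ c → colour c (adjacency f) x) (λ c → adjacency (colour c f) x) ⟨
      sumℤ (λ c → colour c (adjacency f) x + adjacency (colour c f) x)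
        ≡⟨ sum-cong {N} (λ c → trans (colour-adjacency-anticommutator c f x) (sym (*-identityʳ
            (+ 2 * f x)))) ⟩
      sumℤ {N} (λ c → + 2 * f x * 1ℤ)
        ≡⟨ *-distribˡ-sum {N} (+ 2 * f x) (λ _ → 1ℤ) ⟩
      + 2 * f x * sumℤ {N} (λ _ → 1ℤ)
        ≡⟨ cong (λ z → + 2 * f x * z) (sum-one N) ⟩
      + 2 * f x * + N
        ≡⟨ regroup (f x) (+ N) ⟩
      + 2 * (+ N * f x) ∎)
      where
      open ≡-Reasoning
      S = adjacency (adjacency f) x
      functional-sum′ : ∀ x → adjacency (adjacency f) x ≡ sumℤ (λ c → adjacency (colour c f) x)
      functional-sum′ x = trans (sum-cong (λ c → colour-adjacency c f x)) (sum-swap (λ c d → colour c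
          (colour d f) x))
      double : ∀ z → + 2 * z ≡ z + z
      double = solve-∀
      regroup : ∀ z n → + 2 * z * n ≡ + 2 * (n * z)
      regroup = solve-∀

    private
      -- The summand of `adjW` uses a helper local to that definition. Unification recovers it as a
      -- function that can then be analysed case by case.
      summand : ∀ w x y → ∃ λ (F : Fin N → ℤ) → adjW A w x y ≡ sumℤ F
      summand w x y = _ , refl

      summand≡ : ∀ w x y c → proj₁ (summand w x y) c ≡ indicator (nbr c x Fin.≟ y) (w c x)
      summand≡ w x y c with nbr c x Fin.≟ y
      ... | yes _ = refl
      ... | no  _ = refl

    adjW≡ : ∀ w x y → adjW A w x y ≡ sumℤ (λ c → indicator (nbr c x Fin.≟ y) (w c x))
    adjW≡ w x y = trans (proj₂ (summand w x y)) (sum-cong (summand≡ w x y))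

    adjW-sym : ∀ w → (∀ c x → w c (nbr c x) ≡ w c x) → ∀ x y → adjW A w x y ≡ adjW A w y x
    adjW-sym w w-sym x y = begin
      adjW A w x y                                               ≡⟨ adjW≡ w x y ⟩
      sumℤ (λ c → indicator (nbr c x Fin.≟ y) (w c x))
        ≡⟨ sum-cong (λ c → indicator-cong (nbr c x Fin.≟ y) (nbr c y Fin.≟ x)
             (λ { refl → nbr-invol c x }) (λ { refl → nbr-invol c y })
             (λ { refl → sym (w-sym c x) })) ⟩
      sumℤ (λ c → indicator (nbr c y Fin.≟ x) (w c y))           ≡⟨ adjW≡ w y x ⟨
      adjW A w y x                                               ∎
      where open ≡-Reasoning

    δ≡unit : ∀ x y → δ A x y ≡ unit x y
    δ≡unit x y with x Fin.≟ y
    ... | yes _ = refl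
    ... | no  _ = refl

    signedLaplacian-sym : ∀ x y → signedLaplacian A x y ≡ signedLaplacian A y x
    signedLaplacian-sym x y = cong₂ (λ a b → a * sumℤ {N} (λ _ → 1ℤ) - b)
      (trans (δ≡unit x y) (trans (unit-sym x y) (sym (δ≡unit y x))))
      (adjW-sym σ (λ c x → cong (_◃ 1) (sgn-sym c x)) x y)

    matVec-signedLaplacian : ∀ f x → matVec (signedLaplacian A) f x ≡ + N * f x - adjacency f x
    matVec-signedLaplacian f x = begin
      sumℤ (λ y → (δ A x y * sumℤ {N} (λ _ → 1ℤ) - adjW A σ x y) * f y)
        ≡⟨ sum-cong (λ y → trans (cong₂ (λ a b → (a * b - adjW A σ x y) * f y) (δ≡unit x y) (sum-one N))
                                 (expand (unit x y) (+ N) (adjW A σ x y) (f y))) ⟩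
      sumℤ (λ y → (- 1ℤ) * (adjW A σ x y * f y) + + N * (f y * unit x y))
        ≡⟨ sum-linear (- 1ℤ) (λ y → adjW A σ x y * f y) (λ y → + N * (f y * unit x y)) ⟩
      (- 1ℤ) * sumℤ (λ y → adjW A σ x y * f y) + sumℤ (λ y → + N * (f y * unit x y))
        ≡⟨ cong₂ (λ a b → (- 1ℤ) * a + b) adjacency-part
             (trans (*-distribˡ-sum (+ N) (λ y → f y * unit x y)) (cong (λ z → + N * z) (sum-unit x f))) ⟩
      (- 1ℤ) * adjacency f x + + N * f x
        ≡⟨ collect (adjacency f x) (+ N * f x) ⟩
      + N * f x - adjacency f x ∎
      where
      open ≡-Reasoning
      expand : ∀ u n a z → (u * n - a) * z ≡ (- 1ℤ) * (a * z) + n * (z * u)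
      expand = solve-∀
      collect : ∀ a b → (- 1ℤ) * a + b ≡ b - a
      collect = solve-∀
      entry : ∀ y → adjW A σ x y * f y ≡ sumℤ (λ c → indicator (nbr c x Fin.≟ y) (σ c x * f y))
      entry y = begin
        adjW A σ x y * f y                                            ≡⟨ cong (λ z → z * f y)
            (adjW≡ σ x y) ⟩
        sumℤ (λ c → indicator (nbr c x Fin.≟ y) (σ c x)) * f y        ≡⟨ *-comm (sumℤ (λ c → indicator
            (nbr c x Fin.≟ y) (σ c x))) (f y) ⟩
        f y * sumℤ (λ c → indicator (nbr c x Fin.≟ y) (σ c x))        ≡⟨ *-distribˡ-sum (f y)
            (λ c → indicator (nbr c x Fin.≟ y) (σ c x)) ⟨
        sumℤ (λ c → f y * indicator (nbr c x Fin.≟ y) (σ c x))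
          ≡⟨ sum-cong (λ c → trans (*-comm (f y) (indicator (nbr c x Fin.≟ y) (σ c x))) (indicator-*
              (nbr c x Fin.≟ y) (σ c x) (f y))) ⟩
        sumℤ (λ c → indicator (nbr c x Fin.≟ y) (σ c x * f y))        ∎
      adjacency-part : sumℤ (λ y → adjW A σ x y * f y) ≡ adjacency f x
      adjacency-part = begin
        sumℤ (λ y → adjW A σ x y * f y)
          ≡⟨ sum-cong entry ⟩
        sumℤ (λ y → sumℤ (λ c → indicator (nbr c x Fin.≟ y) (σ c x * f y)))
          ≡⟨ sum-swap (λ y c → indicator (nbr c x Fin.≟ y) (σ c x * f y)) ⟩
        sumℤ (λ c → sumℤ (λ y → indicator (nbr c x Fin.≟ y) (σ c x * f y)))
          ≡⟨ sum-cong (λ c → sum-indicator (nbr c x) (λ y → σ c x * f y)) ⟩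
        adjacency f x ∎

    parity-adjW : ∀ x y → parity (adjW A (λ _ _ → 1ℤ) x y) ≡ parity (adjW A σ x y)
    parity-adjW x y = begin
      parity (adjW A (λ _ _ → 1ℤ) x y)   ≡⟨ cong parity (adjW≡ (λ _ _ → 1ℤ) x y) ⟩
      parity (sumℤ (λ c → indicator (nbr c x Fin.≟ y) 1ℤ))
        ≡⟨ parity-sum (λ c → indicator (nbr c x Fin.≟ y) 1ℤ) ⟩
      sumF₂ (λ c → parity (indicator (nbr c x Fin.≟ y) 1ℤ))
        ≡⟨ sumF₂-cong (λ c → same (nbr c x Fin.≟ y) (sgn c x)) ⟩
      sumF₂ (λ c → parity (indicator (nbr c x Fin.≟ y) (σ c x)))
        ≡⟨ parity-sum (λ c → indicator (nbr c x Fin.≟ y) (σ c x)) ⟨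
      parity (sumℤ (λ c → indicator (nbr c x Fin.≟ y) (σ c x)))
        ≡⟨ cong parity (adjW≡ σ x y) ⟨
      parity (adjW A σ x y) ∎
      where
      open ≡-Reasoning
      same : ∀ {P : Set} (p? : Dec P) s → parity (indicator p? 1ℤ) ≡ parity (indicator p? (s ◃ 1))
      same (yes _) Sign.+ = refl
      same (yes _) Sign.- = refl
      same (no  _) s      = refl

    -- Signs disappear mod 2, so the rank assumed for the unsigned graph is a rank of the signed
    -- Laplacian.
    parity-laplacian : ∀ x y → parity (laplacian A x y) ≡ parity (signedLaplacian A x y)
    parity-laplacian x y = begin
      parity (d - adjW A (λ _ _ → 1ℤ) x y)                ≡⟨ parity-minus d (adjW A (λ _ _ → 1ℤ) x y) ⟩
      parity d xor parity (adjW A (λ _ _ → 1ℤ) x y)       ≡⟨ cong (λ b → parity d xor b)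
          (parity-adjW x y) ⟩
      parity d xor parity (adjW A σ x y)                  ≡⟨ parity-minus d (adjW A σ x y) ⟨
      parity (d - adjW A σ x y)                           ∎
      where
      open ≡-Reasoning
      d = δ A x y * degree A x
      parity-minus : ∀ a b → parity (a - b) ≡ parity a xor parity b
      parity-minus a b = trans (cong parity (as-product a b)) (trans (parity-+ a ((- 1ℤ) * b)) (cong
          (λ z → parity a xor z) (parity-* (- 1ℤ) b)))
        where
        as-product : ∀ a b → a - b ≡ a + (- 1ℤ) * b
        as-product = solve-∀

    -- The chosen colour c serves twice: its matching balances the two halves, and its operator
    -- supplies the relation that bounds g.
    adinkra-blockDiagonal : Fin N → N ≢ 0 → BlockDiagonal N (signedLaplacian A)
    adinkra-blockDiagonal c N≢0 = blockDiagonal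
      (balanced (split part) (involution⇒balanced (split part) (nbr c) (nbr-invol c) (part-flips c)))
      N (λ { refl → N≢0 refl }) adjacencyOperator (colourOperator c)
      adjacency-square (colour-adjacency-anticommutator c)
      (signedLaplacian A) matVec-signedLaplacian

-- Counting the blocks, with m the number of those with g = 2

open Development
open import Data.Nat using (ℕ; _≤_; _+_; _*_; _∸_; _/_)

theorem1p2 : (N v : ℕ) → 2 ≤ N → (A : Adinkra N v) → (r : ℕ) →
    RankF₂ (mod2 (laplacian A)) r →
    ∃ λ (m : ℕ) → (r + m ≡ v / 2) ×
    TorsionCokerIso (signedLaplacian A) m (v / 2 ∸ m) ((N * N ∸ N) / 2) (N * N ∸ N)
theorem1p2 (suc N) v 2≤N A r rank = C.m , r+m≡v/2 ,
  subst (λ k → TorsionCokerIso (signedLaplacian A) C.m k C.p C.q) k≡v/2∸m C.cokernel-iso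
  where
  D : BlockDiagonal (suc N) (signedLaplacian A)
  D = adinkra-blockDiagonal A Fin.zero λ ()
  module C = Cokernel 2≤N D

  v/2≡n : v / 2 ≡ BlockDiagonal.n D
  v/2≡n = trans (cong (_/ 2) (trans (BlockDiagonal.v≡n+n D) (double (BlockDiagonal.n D)))) (ℕ.m*n/n≡m
      (BlockDiagonal.n D) 2)
    where
    double : ∀ n → n + n ≡ n * 2
    double n = trans (cong (n +_) (sym (ℕ.+-identityʳ n))) (ℕ.*-comm 2 n)

  k+m≡v/2 : C.k + C.m ≡ v / 2
  k+m≡v/2 = trans C.k+m≡n (sym v/2≡n)

  -- The rank r equals the number k of blocks with g = 1, and all blocks together number n, which is
  -- half of v.
  r+m≡v/2 : r + C.m ≡ v / 2
  r+m≡v/2 = trans (cong (_+ C.m) (Rank.rank≡ {L = signedLaplacian A} {laplacian A}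
      (signedLaplacian-sym A) (parity-laplacian A) D r rank)) k+m≡v/2

  k≡v/2∸m : C.k ≡ v / 2 ∸ C.m
  k≡v/2∸m = trans (sym (ℕ.m+n∸n≡m C.k C.m)) (cong (_∸ C.m) k+m≡v/2)
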